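{- Let $f:\{0,1\}^n\to\{0,1\}$ be a Boolean function and $c\in\mathbb{R}^n_{\ge0}$ a cost vector. For every $\varepsilon\in(0,0.5]$ and $\beta>0$, there exists an $\varepsilon$-error online algorithm with unit investment $\beta$ (namely the algorithm Warmup-IPRR$(f,\varepsilon)$ described in the context) whose expected cost satisfies \[ \mathrm{avg\text{ - }cost}_c \le \beta n + \frac{\mathrm{opt}^{\mathrm{w}}_0(f,c)}{\varepsilon}\sum_{i=1}^n \mathrm{Inf}_i[f]\left(1+\ln\frac{1}{\mathrm{Inf}_i[f]}\right). \]
   Context: Online priced query model: $f:\{0,1\}^n\to\{0,1\}$ is given; the input $x\in\{0,1\}^n$ and costs $c\in\mathbb{R}^n_{\ge0}$ are unknown. The algorithm maintains investments $\theta\in\mathbb{R}^n_{\ge0}$, initially $0$; each step it increases one $\theta_i$ by $\beta$; $x_i$ is revealed once $\theta_i\ge c_i$. The cost on input $x$ is $\|\theta\|_1$ at halting. Offline algorithms know $c$ and pay $c_i$ to reveal $x_i$. An algorithm is $\varepsilon$-error if $\Pr_{x}[\text{output}\ne f(x)]\le\varepsilon$ for uniform $x$. $\mathrm{avg\text{ - }cost}_c$ is the expected cost over uniform $x$; $\mathrm{worst\text{ - }cost}_c$ is the max over $x$. $\mathrm{opt}^{\mathrm{w}}_0(f,c)$ is the infimum of worst-case cost over all zero-error algorithms (offline or online). $\mathrm{Inf}_i[f]=\Pr_x[f(x)\ne f(x^{\oplus i})]$ ($x^{\oplus i}$: $x$ with bit $i$ flipped); terms with $\mathrm{Inf}_i[f]=0$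 contribute $0$. For a restriction $\pi$ (partial assignment of variables), $f_\pi$ is the restricted function, and $\mathrm{bias}(g)=\min\{\Pr_x[g(x)\ne0],\Pr_x[g(x)\ne1]\}$. Warmup-IPRR$(f,\varepsilon)$: start with $\theta=0$, $\pi=\emptyset$; while $\mathrm{bias}(f_\pi)>\varepsilon$: pick $i^*\in\arg\max_i \mathrm{Inf}_i[f_\pi]/\theta_i$, increase $\theta_{i^*}$ by $\beta$, and if $x_{i^*}$ is revealed as $b$, add $x_{i^*}\mapsto b$ to $\pi$; finally output $\mathbf{1}\{\mathbb{E}_x[f_\pi(x)]\ge 1/2\}$. -}

module Defs where

open import Algebra.Bundles using (CommutativeRing)
open import Algebra.Structures using (IsCommutativeRing)
import Algebra.Construct.NaturalChoice.Max as NaturalMax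
import Algebra.Construct.NaturalChoice.Min as NaturalMin
import Algebra.Definitions.RawMonoid as RawMonoidDefinitions
open import Data.Bool.Base using (Bool; true; false; not; _xor_; if_then_else_)
open import Data.Fin.Base using (Fin)
import Data.Fin.Properties as Fin
open import Data.List.Base using (List; []; _∷_)
open import Data.Maybe.Base using (Maybe; just; nothing; fromMaybe)
open import Data.Nat.Base using (ℕ; zero; suc)
open import Data.Product.Base using (∃; ∃₂; _×_; _,_; proj₁; proj₂)
open import Data.Vec.Base using (Vec; []; _∷_; lookup; replicate; zipWith; _[_]%=_; _[_]≔_)
open import Function.Base using (_∘_)
open import Level using (0ℓ)
open import Relation.Binary.Bundles using (DecTotalOrder)
open import Relation.Binary.Core using (Rel)
import Relation.Binary.Construct.Add.Supremum.NonStrict as AddSupremum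
import Relation.Binary.Construct.NonStrictToStrict as ToStrict
open import Relation.Binary.PropositionalEquality.Core using (_≡_)
open import Relation.Binary.Structures using (IsDecTotalOrder)
open import Relation.Nullary.Construct.Add.Supremum using (_⁺; [_]; ⊤⁺)
open import Relation.Nullary.Decidable.Core using (does)
open import Relation.Nullary.Negation.Core using (¬_)

-- The real numbers, axiomatised as a complete ordered field (classically
-- unique up to isomorphism).  The order is decidable and every non-empty
-- bounded set has a supremum, as in classical mathematics.  `_⁻¹` and `⋁` are
-- total, with unspecified values at 0 and at sets that are empty or unbounded.
-- Classically `archimedean` follows from `⋁-upper` and `⋁-least`; without
-- excluded middle these only yield that such an n cannot fail to exist.
record RealField : Set₁ where
  infix  8 _⁻¹
  infix  8 -_
  infixl 7 _*_
  infixl 6 _+_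
  infix  4 _≈_ _≤_
  field
    Carrier : Set
    _≈_ _≤_ : Rel Carrier 0ℓ
    _+_ _*_ : Carrier → Carrier → Carrier
    -_ _⁻¹  : Carrier → Carrier
    0# 1#   : Carrier

    isCommutativeRing : IsCommutativeRing _≈_ _+_ _*_ -_ 0# 1#
    0≉1               : ¬ (0# ≈ 1#)
    ⁻¹-inverse        : ∀ x → ¬ (x ≈ 0#) → x * x ⁻¹ ≈ 1#

    isDecTotalOrder : IsDecTotalOrder _≈_ _≤_
    +-monoˡ-≤       : ∀ z {x y} → x ≤ y → x + z ≤ y + z
    *-nonNegative   : ∀ {x y} → 0# ≤ x → 0# ≤ y → 0# ≤ x * y

  UpperBound : (Carrier → Set) → Carrier → Set
  UpperBound P u = ∀ x → P x → x ≤ u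

  field
    ⋁       : (Carrier → Set) → Carrier
    ⋁-upper : ∀ P → ∃ P → ∃ (UpperBound P) → UpperBound P (⋁ P)
    ⋁-least : ∀ P → ∃ P → ∀ u → UpperBound P u → ⋁ P ≤ u

  commutativeRing : CommutativeRing 0ℓ 0ℓ
  commutativeRing = record { isCommutativeRing = isCommutativeRing }

  decTotalOrder : DecTotalOrder 0ℓ 0ℓ 0ℓ
  decTotalOrder = record { isDecTotalOrder = isDecTotalOrder }

  open CommutativeRing commutativeRing public using (_-_; +-rawMonoid)
  open DecTotalOrder decTotalOrder public using (_≟_; _≤?_; totalOrder)
  open ToStrict _≈_ _≤_ public using (_<_)
  open NaturalMax totalOrder public using (_⊔_)
  open NaturalMin totalOrder public using (_⊓_)
  open RawMonoidDefinitions +-rawMonoid public using (sum) renaming (_×_ to _·_)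

  field
    archimedean : ∀ x → ∃ λ n → x ≤ n · 1#

module PricedQuery (R : RealField) where

  open RealField R renaming (Carrier to ℝ)

  ½ : ℝ
  ½ = (1# + 1#) ⁻¹

  ⋀ : (ℝ → Set) → ℝ
  ⋀ P = - ⋁ (λ x → P (- x))

  -- `LowerSum a b s`: s is the lower Darboux sum of t ↦ 1/t over some
  -- partition of [a , b], where 0 < a.  The infimum of 1/t over [t , u] is 1/u.
  data LowerSum (a : ℝ) : ℝ → ℝ → Set where
    trivial : LowerSum a a 0#
    extend  : ∀ {t u s} → LowerSum a t s → t ≤ u → LowerSum a u (s + (u - t) * u ⁻¹)

  ∫1/t : ℝ → ℝ → ℝ
  ∫1/t a b = ⋁ (LowerSum a b)

  -- Meaningful for positive arguments only.
  ln : ℝ → ℝ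
  ln y = if does (1# ≤? y) then ∫1/t 1# y else - ∫1/t y 1#

  Cube : ℕ → Set
  Cube n = Vec Bool n

  -- Expectation over the uniform distribution on the cube.
  𝔼 : ∀ {n} → (Cube n → ℝ) → ℝ
  𝔼 {zero}  g = g []
  𝔼 {suc n} g = ½ * (𝔼 (g ∘ (false ∷_)) + 𝔼 (g ∘ (true ∷_)))

  maximum : ∀ {n} → (Cube n → ℝ) → ℝ
  maximum {zero}  g = g []
  maximum {suc n} g = maximum (g ∘ (false ∷_)) ⊔ maximum (g ∘ (true ∷_))

  Pr : ∀ {n} → (Cube n → Bool) → ℝ
  Pr p = 𝔼 λ x → if p x then 1# else 0#

  -- On Booleans, `_xor_` is the decision of inequality.
  error : ∀ {n} → (Cube n → Bool) → (Cube n → Bool) → ℝ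
  error f g = Pr λ x → g x xor f x

  Inf : ∀ {n} → Fin n → (Cube n → Bool) → ℝ
  Inf i f = Pr λ x → f x xor f (x [ i ]%= not)

  bias : ∀ {n} → (Cube n → Bool) → ℝ
  bias g = (Pr λ x → g x xor false) ⊓ (Pr λ x → g x xor true)

  Restriction : ℕ → Set
  Restriction n = Vec (Maybe Bool) n

  -- The restricted function is kept as a function of all n variables that
  -- ignores the fixed ones; this changes neither its distribution nor the
  -- influences of the free variables, and fixed variables get influence 0.
  _↾_ : ∀ {n} → (Cube n → Bool) → Restriction n → Cube n → Bool
  (f ↾ π) x = f (zipWith (λ m b → fromMaybe b m) π x)

  -- Offline algorithms.  A tree may be chosen depending on the costs.

  data DecisionTree (n : ℕ) : Set where
    leaf  : Bool → DecisionTree n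
    query : Fin n → (Bool → DecisionTree n) → DecisionTree n

  eval : ∀ {n} → DecisionTree n → Cube n → Bool
  eval (leaf b)    x = b
  eval (query i T) x = eval (T (lookup x i)) x

  offlineCost : ∀ {n} → (Fin n → ℝ) → DecisionTree n → Cube n → ℝ
  offlineCost c (leaf b)    x = 0#
  offlineCost c (query i T) x = c i + offlineCost c (T (lookup x i)) x

  -- Online algorithms.

  -- The investments made so far, most recent first, each with the bit it
  -- revealed, if any.
  History : ℕ → Set
  History n = List (Fin n × Maybe Bool)

  data Action (n : ℕ) : Set where
    invest : Fin n → Action n
    halt   : Bool → Action n

  OnlineAlgorithm : ℕ → Set
  OnlineAlgorithm n = History n → Action n

  investment : ∀ {n} → ℝ → History n → Fin n → ℝ
  investment β []            i = 0#
  investment β ((j , _) ∷ h) i =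
    if does (i Fin.≟ j) then investment β h i + β else investment β h i

  revealed : ∀ {n} → History n → Restriction n
  revealed []                 = replicate _ nothing
  revealed ((i , just b) ∷ h)  = revealed h [ i ]≔ just b
  revealed ((i , nothing) ∷ h) = revealed h

  -- The response to investing β in i after h.  A bit of cost 0 is thus
  -- revealed by the first investment in it.
  response : ∀ {n} → (Fin n → ℝ) → ℝ → Cube n → History n → Fin n → Maybe Bool
  response c β x h i =
    if does (c i ≤? investment β h i + β) then just (lookup x i) else nothing

  data Run {n} (A : OnlineAlgorithm n) (c : Fin n → ℝ) (β : ℝ) (x : Cube n)
         : History n → History n → Bool → Set where
    stop : ∀ {h b} → A h ≡ halt b → Run A c β x h h b
    step : ∀ {h h′ b} i → A h ≡ invest i →
           Run A c β x ((i , response c β x h i) ∷ h) h′ b → Run A c β x h h′ b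

  Halts : ∀ {n} → OnlineAlgorithm n → (Fin n → ℝ) → ℝ → Set
  Halts A c β = ∀ x → ∃₂ λ h b → Run A c β x [] h b

  module _ {n} {A : OnlineAlgorithm n} {c : Fin n → ℝ} {β : ℝ} where

    output : Halts A c β → Cube n → Bool
    output H x = proj₁ (proj₂ (H x))

    onlineCost : Halts A c β → Cube n → ℝ
    onlineCost H x = sum (investment β (proj₁ (H x)))

  -- Worst-case costs of the zero-error algorithms for f, given costs c.
  data ZeroErrorWorstCost {n} (f : Cube n → Bool) (c : Fin n → ℝ) (r : ℝ) : Set where
    offline : (T : DecisionTree n) → error f (eval T) ≤ 0# →
              r ≈ maximum (offlineCost c T) → ZeroErrorWorstCost f c r
    online  : (β : ℝ) → 0# < β → (A : OnlineAlgorithm n) (H : Halts A c β) →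
              error f (output H) ≤ 0# →
              r ≈ maximum (onlineCost H) → ZeroErrorWorstCost f c r

  optʷ₀ : ∀ {n} → (Cube n → Bool) → (Fin n → ℝ) → ℝ
  optʷ₀ f c = ⋀ (ZeroErrorWorstCost f c)

  -- Quotients of non-negative numbers in [0 , ∞], with a/0 = ∞ for a > 0
  -- and 0/0 = 0.
  _÷_ : ℝ → ℝ → ℝ ⁺
  a ÷ t = if does (t ≟ 0#)
          then (if does (a ≟ 0#) then [ 0# ] else ⊤⁺)
          else [ a * t ⁻¹ ]

  open AddSupremum _≤_ using (_≤⁺_)

  _∈argmax_ : ∀ {n} → Fin n → (Fin n → ℝ ⁺) → Set
  i ∈argmax r = ∀ j → r j ≤⁺ r i

  data WarmupStep {n} (f : Cube n → Bool) (ε β : ℝ) (h : History n) : Action n → Set where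
    continue : ε < bias (f ↾ revealed h) → ∀ i →
               i ∈argmax (λ j → Inf j (f ↾ revealed h) ÷ investment β h j) →
               WarmupStep f ε β h (invest i)
    finish   : bias (f ↾ revealed h) ≤ ε →
               WarmupStep f ε β h (halt (does (½ ≤? Pr (f ↾ revealed h))))

  -- A is Warmup-IPRR(f, ε) with unit investment β, for some way of breaking
  -- ties in the choice from the argmax.
  IsWarmupIPRR : ∀ {n} → (Cube n → Bool) → ℝ → ℝ → OnlineAlgorithm n → Set
  IsWarmupIPRR f ε β A = ∀ h → WarmupStep f ε β h (A h)

  -- p (1 + ln (1/p)), extended by 0 at p = 0.
  entropyTerm : ℝ → ℝ
  entropyTerm p = if does (p ≟ 0#) then 0# else p * (1# + ln (p ⁻¹))

{-# OPTIONS --safe #-}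

-- Let k be f restricted by what has been revealed, and let w be the
-- worst-case cost of some zero-error algorithm.  Along such an algorithm's
-- queries, replacing the queried bit of a uniform input x changes k x with
-- probability at most the influence of that bit.  At the end k has become
-- constant, so bias k ≤ M w whenever Inf i k ≤ M cᵢ for all i (a worst-case
-- form of the inequality of O'Donnell, Saks, Schramm and Servedio).  If the
-- algorithm invests in i, this applies with M = Inf i k / θᵢ, because i is in
-- the argmax and θⱼ ≤ cⱼ for every hidden j.  Hence θᵢ ≤ (w / ε) Inf i k, and in
-- the end θᵢ ≤ β + (w / ε) mᵢ, where mᵢ is the largest influence that i ever
-- had.  Until i is revealed its influence is a martingale with values in
-- [0 , 1] starting at p = Inf i f, so 𝔼 mᵢ ≤ p + p ∫ₚ¹ dt/t = p (1 + ln (1/p)) by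
-- Doob's maximal inequality.

module Submission where

open import Defs
open import Algebra.Bundles using (CommutativeRing)
import Algebra.Construct.NaturalChoice.Max as NaturalMax
import Algebra.Construct.NaturalChoice.MaxOp as MaxOp
import Algebra.Construct.NaturalChoice.Min as NaturalMin
import Algebra.Construct.NaturalChoice.MinOp as MinOp
import Algebra.Properties.CommutativeMonoid.Sum as SumProperties
import Algebra.Properties.Ring as RingProperties
import Algebra.Properties.Semiring.Sum as SemiringSum
import Algebra.Solver.Ring.NaturalCoefficients.Default as SemiringSolver
open import Data.Bool.Base using (Bool; true; false; not; _xor_; if_then_else_)
open import Data.Bool.Properties using (xor-comm; xor-same)
open import Data.Empty using (⊥-elim)
open import Data.Fin.Base using (Fin; zero; suc)
import Data.Fin.Properties as Fin
open import Data.List.Base using ([]; _∷_)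
open import Data.Maybe.Base using (just; nothing; fromMaybe)
open import Data.Nat.Base as ℕ using (ℕ; zero; suc)
import Data.Nat.Properties as ℕ
open import Data.Product.Base using (∃; ∃₂; Σ-syntax; _×_; _,_; proj₁; proj₂)
open import Data.Sum.Base using (_⊎_; inj₁; inj₂)
open import Data.Vec.Base as Vec using (Vec; []; _∷_; _[_]≔_; _[_]%=_; lookup; zipWith; replicate; tabulate)
open import Data.Vec.Properties using (lookup-zipWith; lookup∘tabulate; lookup∘update; lookup∘update′; updateAt-commutes)
open import Function.Base using (_∘_; case_of_)
open import Relation.Binary.Bundles using (DecTotalOrder)
import Relation.Binary.Construct.Add.Supremum.NonStrict as AddSupremum
open import Relation.Binary.PropositionalEquality.Core as ≡ using (_≡_; _≢_)
import Relation.Binary.Reasoning.PartialOrder as PartialOrderReasoning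
open import Relation.Nullary.Construct.Add.Supremum using (_⁺; [_]; ⊤⁺)
open import Relation.Nullary.Decidable.Core using (does; yes; no)
open import Relation.Nullary.Negation.Core using (¬_)

-- Arithmetic in an ordered field.

module OrderedField (R : RealField) where

  open RealField R renaming (Carrier to ℝ) public
  open CommutativeRing commutativeRing public
    using ( refl; sym; trans; reflexive; ring; semiring; commutativeSemiring
          ; +-commutativeMonoid; +-cong; +-congˡ; +-congʳ; +-assoc; +-comm
          ; +-identityˡ; +-identityʳ; -‿cong; -‿inverseˡ; -‿inverseʳ
          ; *-congˡ; *-congʳ; *-assoc; *-comm; *-identityˡ; *-identityʳ
          ; distribˡ; distribʳ; zeroˡ; zeroʳ)
  open DecTotalOrder decTotalOrder public
    using (poset)
    renaming ( refl to ≤-refl; reflexive to ≤-reflexive; trans to ≤-trans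
             ; antisym to ≤-antisym; total to ≤-total)
  open RingProperties ring public using (-‿distribˡ-*; -‿distribʳ-*; -‿involutive)
  open MaxOp (NaturalMax.maxOperator totalOrder) public using (x≤x⊔y; x≤y⊔x)
  open MinOp (NaturalMin.minOperator totalOrder) public using (x⊓y≤x; x⊓y≤y; ⊓-glb)
  open PartialOrderReasoning poset public
    hiding (stop; step-<; step-≡; step-≡-∣; step-≡-⟨; step-≡-⟩; step-≡˘)
  open SemiringSolver commutativeSemiring public
    using (solve; _:+_; _:*_; _:=_)
  open SumProperties +-commutativeMonoid public using (sum-replicate; ∑-distrib-+)
  open SemiringSum semiring public using (*-distribˡ-sum)

  infix 4 _≉_
  _≉_ : ℝ → ℝ → Set
  x ≉ y = ¬ x ≈ y

  +-monoʳ-≤ : ∀ z {x y} → x ≤ y → z + x ≤ z + y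
  +-monoʳ-≤ z {x} {y} x≤y = begin
    z + x ≈⟨ +-comm z x ⟩
    x + z ≤⟨ +-monoˡ-≤ z x≤y ⟩
    y + z ≈⟨ +-comm y z ⟩
    z + y ∎

  +-mono-≤ : ∀ {x y u v} → x ≤ y → u ≤ v → x + u ≤ y + v
  +-mono-≤ {y = y} {u} x≤y u≤v = ≤-trans (+-monoˡ-≤ u x≤y) (+-monoʳ-≤ y u≤v)

  x+y-y≈x : ∀ x y → x + y + - y ≈ x
  x+y-y≈x x y = trans (+-assoc x y (- y)) (trans (+-congˡ (-‿inverseʳ y)) (+-identityʳ x))

  x-y+y≈x : ∀ x y → x - y + y ≈ x
  x-y+y≈x x y = trans (+-assoc x (- y) y) (trans (+-congˡ (-‿inverseˡ y)) (+-identityʳ x))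

  +-cancelʳ-≤ : ∀ z {x y} → x + z ≤ y + z → x ≤ y
  +-cancelʳ-≤ z {x} {y} p = begin
    x           ≈⟨ x+y-y≈x x z ⟨
    x + z + - z ≤⟨ +-monoˡ-≤ (- z) p ⟩
    y + z + - z ≈⟨ x+y-y≈x y z ⟩
    y           ∎

  x+y≤z⇒x≤z-y : ∀ {x y z} → x + y ≤ z → x ≤ z - y
  x+y≤z⇒x≤z-y {x} {y} {z} p = +-cancelʳ-≤ y (≤-trans p (≤-reflexive (sym (x-y+y≈x z y))))

  x≤y⇒0≤y-x : ∀ {x y} → x ≤ y → 0# ≤ y - x
  x≤y⇒0≤y-x p = x+y≤z⇒x≤z-y (≤-trans (≤-reflexive (+-identityˡ _)) p)

  -‿anti-≤ : ∀ {x y} → x ≤ y → - y ≤ - x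
  -‿anti-≤ {x} {y} x≤y = +-cancelʳ-≤ y (begin
    - y + y ≈⟨ -‿inverseˡ y ⟩
    0#      ≤⟨ x≤y⇒0≤y-x x≤y ⟩
    y - x   ≈⟨ +-comm y (- x) ⟩
    - x + y ∎)

  x≤x+y : ∀ {x y} → 0# ≤ y → x ≤ x + y
  x≤x+y {x} 0≤y = ≤-trans (≤-reflexive (sym (+-identityʳ x))) (+-monoʳ-≤ x 0≤y)

  +-nonNegative : ∀ {x y} → 0# ≤ x → 0# ≤ y → 0# ≤ x + y
  +-nonNegative 0≤x 0≤y = ≤-trans 0≤x (x≤x+y 0≤y)

  *-monoˡ-≤ : ∀ {z x y} → 0# ≤ z → x ≤ y → z * x ≤ z * y
  *-monoˡ-≤ {z} {x} {y} 0≤z x≤y = begin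
    z * x                 ≈⟨ +-identityˡ _ ⟨
    0# + z * x            ≤⟨ +-monoˡ-≤ (z * x) (*-nonNegative 0≤z (x≤y⇒0≤y-x x≤y)) ⟩
    z * (y - x) + z * x   ≈⟨ distribˡ z (y - x) x ⟨
    z * (y - x + x)       ≈⟨ *-congˡ (x-y+y≈x y x) ⟩
    z * y                 ∎

  *-monoʳ-≤ : ∀ {z x y} → 0# ≤ z → x ≤ y → x * z ≤ y * z
  *-monoʳ-≤ {z} {x} {y} 0≤z x≤y = begin
    x * z ≈⟨ *-comm x z ⟩
    z * x ≤⟨ *-monoˡ-≤ 0≤z x≤y ⟩
    z * y ≈⟨ *-comm z y ⟩
    y * z ∎

  -x*-x≈x*x : ∀ x → - x * - x ≈ x * x
  -x*-x≈x*x x = trans (sym (-‿distribˡ-* x (- x)))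
    (trans (-‿cong (sym (-‿distribʳ-* x x))) (-‿involutive _))

  0≤1 : 0# ≤ 1#
  0≤1 with ≤-total 0# 1#
  ... | inj₁ p = p
  ... | inj₂ p = begin
    0#          ≤⟨ *-nonNegative 0≤-1 0≤-1 ⟩
    - 1# * - 1# ≈⟨ trans (-x*-x≈x*x 1#) (*-identityˡ 1#) ⟩
    1#          ∎
    where
    0≤-1 : 0# ≤ - 1#
    0≤-1 = ≤-trans (x≤y⇒0≤y-x p) (≤-reflexive (+-identityˡ _))

  ≰⇒≥ : ∀ {x y} → ¬ x ≤ y → y ≤ x
  ≰⇒≥ {x} {y} x≰y with ≤-total x y
  ... | inj₁ x≤y = ⊥-elim (x≰y x≤y)
  ... | inj₂ y≤x = y≤x

  <⇒≉ : ∀ {x y} → x < y → y ≉ x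
  <⇒≉ (_ , x≉y) y≈x = x≉y (sym y≈x)

  ≥∧≉⇒> : ∀ {x y} → x ≤ y → y ≉ x → x < y
  ≥∧≉⇒> x≤y y≉x = x≤y , y≉x ∘ sym

  <-≤-trans : ∀ {x y z} → x < y → y ≤ z → x < z
  <-≤-trans (x≤y , x≉y) y≤z =
    ≤-trans x≤y y≤z , λ x≈z → x≉y (≤-antisym x≤y (≤-trans y≤z (≤-reflexive (sym x≈z))))

  <-irrefl : ∀ {x} → ¬ x < x
  <-irrefl (_ , x≉x) = x≉x refl

  ⁻¹-inverseˡ : ∀ {x} → x ≉ 0# → x ⁻¹ * x ≈ 1#
  ⁻¹-inverseˡ {x} x≉0 = trans (*-comm _ _) (⁻¹-inverse x x≉0)

  ⁻¹-nonNegative : ∀ {x} → 0# < x → 0# ≤ x ⁻¹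
  ⁻¹-nonNegative {x} 0<x@(0≤x , _) with ≤-total 0# (x ⁻¹)
  ... | inj₁ p = p
  ... | inj₂ p = ⊥-elim (0≉1 (≤-antisym 0≤1 (begin
    1#       ≈⟨ ⁻¹-inverse x (<⇒≉ 0<x) ⟨
    x * x ⁻¹ ≤⟨ *-monoˡ-≤ 0≤x p ⟩
    x * 0#   ≈⟨ zeroʳ x ⟩
    0#       ∎)))

  ⁻¹-positive : ∀ {x} → 0# < x → 0# < x ⁻¹
  ⁻¹-positive {x} 0<x = ⁻¹-nonNegative 0<x , λ 0≈x⁻¹ → 0≉1 (begin-equality
    0#       ≈⟨ zeroʳ x ⟨
    x * 0#   ≈⟨ *-congˡ 0≈x⁻¹ ⟩
    x * x ⁻¹ ≈⟨ ⁻¹-inverse x (<⇒≉ 0<x) ⟩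
    1#       ∎)

  x*y*y⁻¹≈x : ∀ x {y} → y ≉ 0# → x * y * y ⁻¹ ≈ x
  x*y*y⁻¹≈x x y≉0 = trans (*-assoc _ _ _) (trans (*-congˡ (⁻¹-inverse _ y≉0)) (*-identityʳ x))

  x*y⁻¹*y≈x : ∀ x {y} → y ≉ 0# → x * y ⁻¹ * y ≈ x
  x*y⁻¹*y≈x x y≉0 = trans (*-assoc _ _ _) (trans (*-congˡ (⁻¹-inverseˡ y≉0)) (*-identityʳ x))

  x≤y*z⁻¹⇒x*z≤y : ∀ {x y z} → 0# < z → x ≤ y * z ⁻¹ → x * z ≤ y
  x≤y*z⁻¹⇒x*z≤y 0<z p = ≤-trans (*-monoʳ-≤ (proj₁ 0<z) p) (≤-reflexive (x*y⁻¹*y≈x _ (<⇒≉ 0<z)))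

  x*y⁻¹≤z⇒x≤z*y : ∀ {x y z} → 0# < y → x * y ⁻¹ ≤ z → x ≤ z * y
  x*y⁻¹≤z⇒x≤z*y 0<y p = ≤-trans (≤-reflexive (sym (x*y⁻¹*y≈x _ (<⇒≉ 0<y)))) (*-monoʳ-≤ (proj₁ 0<y) p)

  x*y≤z⇒x≤z*y⁻¹ : ∀ {x y z} → 0# < y → x * y ≤ z → x ≤ z * y ⁻¹
  x*y≤z⇒x≤z*y⁻¹ 0<y p =
    ≤-trans (≤-reflexive (sym (x*y*y⁻¹≈x _ (<⇒≉ 0<y)))) (*-monoʳ-≤ (⁻¹-nonNegative 0<y) p)

  x≤y*z⇒x*z⁻¹≤y : ∀ {x y z} → 0# < z → x ≤ y * z → x * z ⁻¹ ≤ y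
  x≤y*z⇒x*z⁻¹≤y 0<z p =
    ≤-trans (*-monoʳ-≤ (⁻¹-nonNegative 0<z) p) (≤-reflexive (x*y*y⁻¹≈x _ (<⇒≉ 0<z)))

  sum-mono-≤ : ∀ {n} {s t : Fin n → ℝ} → (∀ i → s i ≤ t i) → sum s ≤ sum t
  sum-mono-≤ {zero}  p = ≤-refl
  sum-mono-≤ {suc n} p = +-mono-≤ (p zero) (sum-mono-≤ (p ∘ suc))

  -- Keeps the gain `x` made at the single index `i`; this is how one more query enters a total of
  -- costs in `online-certificate`.
  sum-mono-≤-at : ∀ {n} {s t : Fin n → ℝ} {x} i → s i + x ≤ t i → (∀ j → ¬ j ≡ i → s j ≤ t j) →
                  sum s + x ≤ sum t
  sum-mono-≤-at {suc n} {s} {t} {x} zero p q = begin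
    s zero + sum (s ∘ suc) + x   ≈⟨ solve 3 (λ a b c → (a :+ b) :+ c := (a :+ c) :+ b) refl _ _ _ ⟩
    s zero + x + sum (s ∘ suc)   ≤⟨ +-mono-≤ p (sum-mono-≤ λ j → q (suc j) λ ()) ⟩
    t zero + sum (t ∘ suc)       ∎
  sum-mono-≤-at {suc n} {s} {t} {x} (suc i) p q = begin
    s zero + sum (s ∘ suc) + x   ≈⟨ +-assoc _ _ _ ⟩
    s zero + (sum (s ∘ suc) + x)
      ≤⟨ +-mono-≤ (q zero λ ()) (sum-mono-≤-at i p λ j j≢i → q (suc j) λ { ≡.refl → j≢i ≡.refl }) ⟩
    t zero + sum (t ∘ suc)       ∎

  sum-nonNegative : ∀ {n} {t : Fin n → ℝ} → (∀ i → 0# ≤ t i) → 0# ≤ sum t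
  sum-nonNegative {zero}  p = ≤-refl
  sum-nonNegative {suc n} p = +-nonNegative (p zero) (sum-nonNegative (p ∘ suc))

  k·1*x≈k·x : ∀ k x → k · 1# * x ≈ k · x
  k·1*x≈k·x zero    x = zeroˡ x
  k·1*x≈k·x (suc k) x = trans (distribʳ x 1# (k · 1#)) (+-cong (*-identityˡ x) (k·1*x≈k·x k x))

-- Expectations over the cube.

module Expectation (R : RealField) where

  open OrderedField R
  open PricedQuery R

  0<1+1 : 0# < 1# + 1#
  0<1+1 = <-≤-trans (0≤1 , 0≉1) (x≤x+y 0≤1)

  0≤½ : 0# ≤ ½
  0≤½ = ⁻¹-nonNegative 0<1+1

  ½*[x+x]≈x : ∀ x → ½ * (x + x) ≈ x
  ½*[x+x]≈x x = begin-equality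
    ½ * (x + x)           ≈⟨ *-congˡ (+-cong (*-identityˡ x) (*-identityˡ x)) ⟨
    ½ * (1# * x + 1# * x) ≈⟨ solve 3 (λ h o x → h :* (o :* x :+ o :* x) := (h :* (o :+ o)) :* x) refl ½ 1# x ⟩
    ½ * (1# + 1#) * x     ≈⟨ *-congʳ (⁻¹-inverseˡ (<⇒≉ 0<1+1)) ⟩
    1# * x                ≈⟨ *-identityˡ x ⟩
    x                     ∎

  average-mono : ∀ {x y u v} → x ≤ u → y ≤ v → ½ * (x + y) ≤ ½ * (u + v)
  average-mono p q = *-monoˡ-≤ 0≤½ (+-mono-≤ p q)

  average-cong : ∀ {x y u v} → x ≈ u → y ≈ v → ½ * (x + y) ≈ ½ * (u + v)
  average-cong p q = *-congˡ (+-cong p q)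

  average-+ : ∀ x y u v → ½ * ((x + y) + (u + v)) ≈ ½ * (x + u) + ½ * (y + v)
  average-+ = solve 5 (λ h x y u v → h :* ((x :+ y) :+ (u :+ v)) := h :* (x :+ u) :+ h :* (y :+ v)) refl ½

  x≤½⇒x+x≤1 : ∀ {x} → x ≤ ½ → x + x ≤ 1#
  x≤½⇒x+x≤1 {x} x≤½ = begin
    x + x         ≤⟨ +-mono-≤ x≤½ x≤½ ⟩
    ½ + ½         ≈⟨ +-cong (*-identityʳ ½) (*-identityʳ ½) ⟨
    ½ * 1# + ½ * 1# ≈⟨ distribˡ ½ 1# 1# ⟨
    ½ * (1# + 1#) ≈⟨ ½*[x+x]≈x 1# ⟩
    1#            ∎

  ½≤x⇒1≤x+x : ∀ {x} → ½ ≤ x → 1# ≤ x + x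
  ½≤x⇒1≤x+x {x} ½≤x = begin
    1#            ≈⟨ ½*[x+x]≈x 1# ⟨
    ½ * (1# + 1#) ≈⟨ distribˡ ½ 1# 1# ⟩
    ½ * 1# + ½ * 1# ≈⟨ +-cong (*-identityʳ ½) (*-identityʳ ½) ⟩
    ½ + ½         ≤⟨ +-mono-≤ ½≤x ½≤x ⟩
    x + x         ∎

  𝔼-mono : ∀ {n} {g k : Cube n → ℝ} → (∀ x → g x ≤ k x) → 𝔼 g ≤ 𝔼 k
  𝔼-mono {zero}  p = p []
  𝔼-mono {suc n} p = average-mono (𝔼-mono (p ∘ (false ∷_))) (𝔼-mono (p ∘ (true ∷_)))

  𝔼-cong : ∀ {n} {g k : Cube n → ℝ} → (∀ x → g x ≈ k x) → 𝔼 g ≈ 𝔼 k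
  𝔼-cong p = ≤-antisym (𝔼-mono (≤-reflexive ∘ p)) (𝔼-mono (≤-reflexive ∘ sym ∘ p))

  𝔼-cong-≗ : ∀ {n} {g k : Cube n → ℝ} → (∀ x → g x ≡ k x) → 𝔼 g ≈ 𝔼 k
  𝔼-cong-≗ p = 𝔼-cong (reflexive ∘ p)

  𝔼-const : ∀ {n} (a : ℝ) → 𝔼 {n} (λ _ → a) ≈ a
  𝔼-const {zero}  a = refl
  𝔼-const {suc n} a = trans (average-cong (𝔼-const {n} a) (𝔼-const {n} a)) (½*[x+x]≈x a)

  𝔼-+ : ∀ {n} (g k : Cube n → ℝ) → 𝔼 (λ x → g x + k x) ≈ 𝔼 g + 𝔼 k
  𝔼-+ {zero}  g k = refl
  𝔼-+ {suc n} g k = trans (average-cong (𝔼-+ {n} _ _) (𝔼-+ {n} _ _)) (average-+ _ _ _ _)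

  𝔼-sum : ∀ {n m} (g : Fin m → Cube n → ℝ) → 𝔼 (λ x → sum (λ i → g i x)) ≈ sum (λ i → 𝔼 (g i))
  𝔼-sum {n} {zero}  g = 𝔼-const {n} 0#
  𝔼-sum {n} {suc m} g = trans (𝔼-+ {n} _ _) (+-congˡ (𝔼-sum (g ∘ suc)))

  -- At `zero`, overwriting the first bit makes the two halves of each inner expectation equal.
  -- Deeper in, the four quarters are regrouped.
  𝔼-split : ∀ {n} i (g : Cube n → ℝ) →
            𝔼 g ≈ ½ * (𝔼 (λ x → g (x [ i ]≔ false)) + 𝔼 (λ x → g (x [ i ]≔ true)))
  𝔼-split zero    g = sym (average-cong (½*[x+x]≈x _) (½*[x+x]≈x _))
  𝔼-split (suc i) g = trans
    (average-cong (𝔼-split i (g ∘ (false ∷_))) (𝔼-split i (g ∘ (true ∷_))))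
    (solve 5 (λ h a b c d → h :* (h :* (a :+ b) :+ h :* (c :+ d)) :=
                            h :* (h :* (a :+ c) :+ h :* (b :+ d))) refl ½ _ _ _ _)

  𝔼-nonNegative : ∀ {n} {g : Cube n → ℝ} → (∀ x → 0# ≤ g x) → 0# ≤ 𝔼 g
  𝔼-nonNegative {n} p = ≤-trans (≤-reflexive (sym (𝔼-const {n} 0#))) (𝔼-mono p)

  -- Both halves of the expectation are non-negative, so neither exceeds their sum. This turns a
  -- vanishing error probability into correctness on every input.
  𝔼≤0⇒≤0 : ∀ {n} {g : Cube n → ℝ} → (∀ x → 0# ≤ g x) → 𝔼 g ≤ 0# → ∀ x → g x ≤ 0#
  𝔼≤0⇒≤0 {zero}      0≤g 𝔼g≤0 [] = 𝔼g≤0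
  𝔼≤0⇒≤0 {suc n} {g} 0≤g 𝔼g≤0 (b ∷ x) = 𝔼≤0⇒≤0 (0≤g ∘ (b ∷_)) (half b) x
    where
    E : Bool → ℝ
    E b = 𝔼 (g ∘ (b ∷_))
    0≤E : ∀ b → 0# ≤ E b
    0≤E b = 𝔼-nonNegative (0≤g ∘ (b ∷_))
    total≤0 : E false + E true ≤ 0#
    total≤0 = begin
      E false + E true ≈⟨ ½*[x+x]≈x _ ⟨
      ½ * ((E false + E true) + (E false + E true)) ≈⟨ distribˡ ½ _ _ ⟩
      𝔼 g + 𝔼 g        ≤⟨ +-mono-≤ 𝔼g≤0 𝔼g≤0 ⟩
      0# + 0#          ≈⟨ +-identityˡ 0# ⟩
      0#               ∎
    half : ∀ b → E b ≤ 0#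
    half false = ≤-trans (x≤x+y (0≤E true)) total≤0
    half true  = ≤-trans (≤-trans (x≤x+y (0≤E false)) (≤-reflexive (+-comm _ _))) total≤0

  x≤maximum : ∀ {n} (g : Cube n → ℝ) x → g x ≤ maximum g
  x≤maximum g []          = ≤-refl
  x≤maximum g (false ∷ x) = ≤-trans (x≤maximum (g ∘ (false ∷_)) x) (x≤x⊔y _ _)
  x≤maximum g (true  ∷ x) = ≤-trans (x≤maximum (g ∘ (true ∷_)) x) (x≤y⊔x _ _)

  -- Indicators, errors, influences and bias.

  𝟙 : Bool → ℝ
  𝟙 b = if b then 1# else 0#

  0≤𝟙 : ∀ b → 0# ≤ 𝟙 b
  0≤𝟙 false = ≤-refl
  0≤𝟙 true  = 0≤1

  𝟙≤1 : ∀ b → 𝟙 b ≤ 1#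
  𝟙≤1 false = 0≤1
  𝟙≤1 true  = ≤-refl

  𝟙-triangle : ∀ a b c → 𝟙 (a xor c) ≤ 𝟙 (a xor b) + 𝟙 (b xor c)
  𝟙-triangle false false c = ≤-reflexive (sym (+-identityˡ _))
  𝟙-triangle true  true  c = ≤-reflexive (sym (+-identityˡ _))
  𝟙-triangle false true  c = ≤-trans (𝟙≤1 c) (x≤x+y (0≤𝟙 (not c)))
  𝟙-triangle true  false c = ≤-trans (𝟙≤1 (not c)) (x≤x+y (0≤𝟙 c))

  𝟙-xor≤0⇒≡ : ∀ a b → 𝟙 (a xor b) ≤ 0# → a ≡ b
  𝟙-xor≤0⇒≡ false false p = ≡.refl
  𝟙-xor≤0⇒≡ true  true  p = ≡.refl
  𝟙-xor≤0⇒≡ false true  p = ⊥-elim (0≉1 (≤-antisym 0≤1 p))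
  𝟙-xor≤0⇒≡ true  false p = ⊥-elim (0≉1 (≤-antisym 0≤1 p))

  error≤0⇒≗ : ∀ {n} {f g : Cube n → Bool} → error f g ≤ 0# → ∀ x → g x ≡ f x
  error≤0⇒≗ p x = 𝟙-xor≤0⇒≡ _ _ (𝔼≤0⇒≤0 (λ x → 0≤𝟙 _) p x)

  ≗⇒error≤0 : ∀ {n} {f g : Cube n → Bool} → (∀ x → g x ≡ f x) → error f g ≤ 0#
  ≗⇒error≤0 {n} {f} {g} p = ≤-reflexive (trans (𝔼-cong-≗ λ x → lemma (g x) (f x) (p x)) (𝔼-const {n} 0#))
    where
    lemma : ∀ a b → a ≡ b → 𝟙 (a xor b) ≡ 0#
    lemma false false _ = ≡.refl
    lemma true  true  _ = ≡.refl

  Pr-nonNegative : ∀ {n} (p : Cube n → Bool) → 0# ≤ Pr p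
  Pr-nonNegative p = 𝔼-nonNegative (0≤𝟙 ∘ p)

  Pr≤1 : ∀ {n} (p : Cube n → Bool) → Pr p ≤ 1#
  Pr≤1 {n} p = ≤-trans (𝔼-mono (𝟙≤1 ∘ p)) (≤-reflexive (𝔼-const {n} 1#))

  Inf-nonNegative : ∀ {n} i (f : Cube n → Bool) → 0# ≤ Inf i f
  Inf-nonNegative i f = Pr-nonNegative λ x → f x xor f (x [ i ]%= not)

  Inf≤1 : ∀ {n} i (f : Cube n → Bool) → Inf i f ≤ 1#
  Inf≤1 i f = Pr≤1 λ x → f x xor f (x [ i ]%= not)

  bias≤error-const : ∀ {n} (g : Cube n → Bool) b → bias g ≤ error g (λ _ → b)
  bias≤error-const g b = ≤-trans (pick b) (≤-reflexive (𝔼-cong-≗ λ x → ≡.cong 𝟙 (xor-comm (g x) b)))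
    where
    pick : ∀ b → bias g ≤ Pr (λ x → g x xor b)
    pick false = x⊓y≤x _ _
    pick true  = x⊓y≤y _ _

  Pr-complement : ∀ {n} (g : Cube n → Bool) → Pr g + Pr (not ∘ g) ≈ 1#
  Pr-complement {n} g = trans (sym (𝔼-+ {n} _ _)) (trans (𝔼-cong (lemma ∘ g)) (𝔼-const {n} 1#))
    where
    lemma : ∀ b → 𝟙 b + 𝟙 (not b) ≈ 1#
    lemma false = +-identityˡ 1#
    lemma true  = +-identityʳ 1#

  -- The probabilities of the two values add up to 1, so the comparison with `½` tells which is the
  -- smaller one, and the constant output errs exactly there.
  error-majority≤bias : ∀ {n} (g : Cube n → Bool) → error g (λ _ → does (½ ≤? Pr g)) ≤ bias g
  error-majority≤bias g with ½ ≤? Pr g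
  ... | yes ½≤p = ⊓-glb (≤-trans q≤p (≤-reflexive p≈)) (≤-reflexive q≈)
    where
    p≈ : Pr g ≈ Pr (λ x → g x xor false)
    p≈ = 𝔼-cong-≗ λ x → ≡.cong 𝟙 (xor-comm false (g x))
    q≈ : Pr (not ∘ g) ≈ Pr (λ x → g x xor true)
    q≈ = 𝔼-cong-≗ λ x → ≡.cong 𝟙 (xor-comm true (g x))
    q≤p : Pr (not ∘ g) ≤ Pr g
    q≤p = +-cancelʳ-≤ (Pr g) (begin
      Pr (not ∘ g) + Pr g ≈⟨ +-comm _ _ ⟩
      Pr g + Pr (not ∘ g) ≈⟨ Pr-complement g ⟩
      1#                  ≤⟨ ½≤x⇒1≤x+x ½≤p ⟩
      Pr g + Pr g         ∎)
  ... | no ½≰p = ⊓-glb (≤-reflexive p≈) (≤-trans p≤q (≤-reflexive q≈))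
    where
    p≈ : Pr g ≈ Pr (λ x → g x xor false)
    p≈ = 𝔼-cong-≗ λ x → ≡.cong 𝟙 (xor-comm false (g x))
    q≈ : Pr (not ∘ g) ≈ Pr (λ x → g x xor true)
    q≈ = 𝔼-cong-≗ λ x → ≡.cong 𝟙 (xor-comm true (g x))
    p≤q : Pr g ≤ Pr (not ∘ g)
    p≤q = +-cancelʳ-≤ (Pr g) (begin
      Pr g + Pr g         ≤⟨ x≤½⇒x+x≤1 (≰⇒≥ ½≰p) ⟩
      1#                  ≈⟨ Pr-complement g ⟨
      Pr g + Pr (not ∘ g) ≈⟨ +-comm _ _ ⟩
      Pr (not ∘ g) + Pr g ∎)

  -- The logarithm as a supremum of lower sums.

  -- ∫ₘ¹ dt/t, for 0 < m ≤ 1.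
  L : ℝ → ℝ
  L m = ln (m ⁻¹)

  m≤1⇒1≤m⁻¹ : ∀ {m} → 0# < m → m ≤ 1# → 1# ≤ m ⁻¹
  m≤1⇒1≤m⁻¹ {m} 0<m m≤1 = begin
    1#       ≈⟨ ⁻¹-inverse m (<⇒≉ 0<m) ⟨
    m * m ⁻¹ ≤⟨ *-monoʳ-≤ (⁻¹-nonNegative 0<m) m≤1 ⟩
    1# * m ⁻¹ ≈⟨ *-identityˡ _ ⟩
    m ⁻¹     ∎

  L≡∫1/t : ∀ {m} → 0# < m → m ≤ 1# → L m ≡ ∫1/t 1# (m ⁻¹)
  L≡∫1/t {m} 0<m m≤1 with 1# ≤? (m ⁻¹)
  ... | yes _ = ≡.refl
  ... | no ¬p = ⊥-elim (¬p (m≤1⇒1≤m⁻¹ 0<m m≤1))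

  x≥1⇒x⁻¹≤1 : ∀ {x} → 1# ≤ x → x ⁻¹ ≤ 1#
  x≥1⇒x⁻¹≤1 {x} 1≤x = begin
    x ⁻¹      ≈⟨ *-identityˡ _ ⟨
    1# * x ⁻¹ ≤⟨ *-monoʳ-≤ (⁻¹-nonNegative 0<x) 1≤x ⟩
    x * x ⁻¹  ≈⟨ ⁻¹-inverse x (<⇒≉ 0<x) ⟩
    1#        ∎
    where
    0<x : 0# < x
    0<x = <-≤-trans (0≤1 , 0≉1) 1≤x

  -- All endpoints are at least 1, where 1/t is at most 1, so each interval contributes at most its
  -- length. The lower sums are thereby bounded, as `⋁-upper` requires.
  LowerSum-bound : ∀ {y s} → LowerSum 1# y s → 1# ≤ y × s + 1# ≤ y
  LowerSum-bound trivial = ≤-refl , ≤-reflexive (+-identityˡ 1#)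
  LowerSum-bound (extend {t} {u} {s} S t≤u) with LowerSum-bound S
  ... | 1≤t , s+1≤t = 1≤u , (begin
    s + (u - t) * u ⁻¹ + 1# ≈⟨ solve 3 (λ a b c → (a :+ b) :+ c := b :+ (a :+ c)) refl _ _ _ ⟩
    (u - t) * u ⁻¹ + (s + 1#) ≤⟨ +-mono-≤ (*-monoˡ-≤ (x≤y⇒0≤y-x t≤u) (x≥1⇒x⁻¹≤1 1≤u)) s+1≤t ⟩
    (u - t) * 1# + t        ≈⟨ +-congʳ (*-identityʳ _) ⟩
    u - t + t               ≈⟨ x-y+y≈x u t ⟩
    u                       ∎)
    where
    1≤u : 1# ≤ u
    1≤u = ≤-trans 1≤t t≤u

  LowerSum≤L : ∀ {m s} → 0# < m → m ≤ 1# → LowerSum 1# (m ⁻¹) s → s ≤ L m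
  LowerSum≤L {m} {s} 0<m m≤1 S =
    ≤-trans (⋁-upper _ (s , S) (m ⁻¹ , bounded) s S) (≤-reflexive (reflexive (≡.sym (L≡∫1/t 0<m m≤1))))
    where
    bounded : UpperBound (LowerSum 1# (m ⁻¹)) (m ⁻¹)
    bounded s S = ≤-trans (x≤x+y 0≤1) (proj₂ (LowerSum-bound S))

  oneStep : ∀ {m} → 0# < m → m ≤ 1# → LowerSum 1# (m ⁻¹) (0# + (m ⁻¹ - 1#) * (m ⁻¹) ⁻¹)
  oneStep 0<m m≤1 = extend trivial (m≤1⇒1≤m⁻¹ 0<m m≤1)

  0≤L : ∀ {m} → 0# < m → m ≤ 1# → 0# ≤ L m
  0≤L {m} 0<m m≤1 = ≤-trans
    (+-nonNegative ≤-refl (*-nonNegative (x≤y⇒0≤y-x (m≤1⇒1≤m⁻¹ 0<m m≤1)) (⁻¹-nonNegative (⁻¹-positive 0<m))))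
    (LowerSum≤L 0<m m≤1 (oneStep 0<m m≤1))

  -- That is, u - m ≤ u ∫ₘᵘ dt/t, by the lower sum of 1/t over a single interval.
  L-step : ∀ {m u} → 0# < m → m ≤ u → u ≤ 1# → u + u * L u ≤ m + u * L m
  L-step {m} {u} 0<m m≤u u≤1 = begin
    u + u * L u             ≤⟨ +-monoʳ-≤ u (*-monoˡ-≤ (proj₁ 0<u) Lu≤) ⟩
    u + u * (L m - d)       ≈⟨ +-congʳ u*d+m≈u ⟨
    u * d + m + u * (L m - d) ≈⟨ solve 4 (λ u d m e → (u :* d :+ m) :+ u :* e := m :+ u :* (e :+ d)) refl u d m _ ⟩
    m + u * (L m - d + d)   ≈⟨ +-congˡ (*-congˡ (x-y+y≈x _ _)) ⟩
    m + u * L m             ∎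
    where
    0<u : 0# < u
    0<u = <-≤-trans 0<m m≤u
    -- The lower sum of 1/t over the single interval from 1/u to 1/m, chosen so that `u * d` is u -
    -- m.
    d : ℝ
    d = (m ⁻¹ - u ⁻¹) * (m ⁻¹) ⁻¹
    u⁻¹≤m⁻¹ : u ⁻¹ ≤ m ⁻¹
    u⁻¹≤m⁻¹ = begin
      u ⁻¹      ≈⟨ *-identityˡ _ ⟨
      1# * u ⁻¹ ≤⟨ x≤y*z⇒x*z⁻¹≤y 0<u (begin
        1#       ≈⟨ ⁻¹-inverseˡ (<⇒≉ 0<m) ⟨
        m ⁻¹ * m ≤⟨ *-monoˡ-≤ (⁻¹-nonNegative 0<m) m≤u ⟩
        m ⁻¹ * u ∎) ⟩
      m ⁻¹      ∎
    -- Every partition of [1, 1/u] extends by that interval to one of [1, 1/m]; then the supremum is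
    -- taken over the former.
    Lu≤ : L u ≤ L m - d
    Lu≤ = ≤-trans (≤-reflexive (reflexive (L≡∫1/t 0<u u≤1)))
      (⋁-least _ (_ , oneStep 0<u u≤1) _ λ s S →
        x+y≤z⇒x≤z-y (LowerSum≤L 0<m (≤-trans m≤u u≤1) (extend S u⁻¹≤m⁻¹)))
    w : ℝ
    w = (m ⁻¹) ⁻¹
    w≈m : w ≈ m
    w≈m = begin-equality
      w            ≈⟨ *-identityˡ w ⟨
      1# * w       ≈⟨ *-congʳ (⁻¹-inverse m (<⇒≉ 0<m)) ⟨
      m * m ⁻¹ * w ≈⟨ x*y*y⁻¹≈x m (<⇒≉ (⁻¹-positive 0<m)) ⟩
      m            ∎
    u*d+m≈u : u * d + m ≈ u
    u*d+m≈u = begin-equality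
      u * ((m ⁻¹ - u ⁻¹) * w) + m              ≈⟨ +-congˡ w≈m ⟨
      u * ((m ⁻¹ - u ⁻¹) * w) + w              ≈⟨ +-congˡ (*-identityˡ w) ⟨
      u * ((m ⁻¹ - u ⁻¹) * w) + 1# * w         ≈⟨ +-congˡ (*-congʳ (⁻¹-inverse u (<⇒≉ 0<u))) ⟨
      u * ((m ⁻¹ - u ⁻¹) * w) + u * u ⁻¹ * w
        ≈⟨ solve 4 (λ u e v w → u :* (e :* w) :+ (u :* v) :* w := u :* ((e :+ v) :* w)) refl u _ _ w ⟩
      u * ((m ⁻¹ - u ⁻¹ + u ⁻¹) * w)           ≈⟨ *-congˡ (*-congʳ (x-y+y≈x _ _)) ⟩
      u * (m ⁻¹ * w)                           ≈⟨ *-congˡ (⁻¹-inverse (m ⁻¹) (<⇒≉ (⁻¹-positive 0<m))) ⟩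
      u * 1#                                   ≈⟨ *-identityʳ u ⟩
      u                                        ∎

  -- `m` may be 0, where `L m` carries no meaning; but then `p` is 0 too and the product vanishes
  -- whatever `L m` is.
  0≤p*Lm : ∀ {p m} → 0# ≤ p → p ≤ m → m ≤ 1# → 0# ≤ p * L m
  0≤p*Lm {p} {m} 0≤p p≤m m≤1 with p ≟ 0#
  ... | yes p≈0 = ≤-reflexive (sym (trans (*-congʳ p≈0) (zeroˡ _)))
  ... | no p≉0  = *-nonNegative 0≤p (0≤L (<-≤-trans (≥∧≉⇒> 0≤p p≉0) p≤m) m≤1)

  entropyTerm≈ : ∀ p → p + p * L p ≈ entropyTerm p
  entropyTerm≈ p with p ≟ 0#
  ... | yes p≈0 = trans (+-cong p≈0 (trans (*-congʳ p≈0) (zeroˡ _))) (+-identityˡ 0#)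
  ... | no _    = sym (trans (distribˡ p 1# (L p)) (+-congʳ (*-identityʳ p)))

  0≤entropyTerm : ∀ {p} → 0# ≤ p → p ≤ 1# → 0# ≤ entropyTerm p
  0≤entropyTerm {p} 0≤p p≤1 =
    ≤-trans (+-nonNegative 0≤p (0≤p*Lm 0≤p ≤-refl p≤1)) (≤-reflexive (entropyTerm≈ p))

-- Restrictions and the influences of restricted functions.

just≢nothing : ∀ {a} {A : Set a} {x : A} {m} → m ≡ just x → m ≢ nothing
just≢nothing ≡.refl ()

update-commutes-flip : ∀ {n} {i j : Fin n} {b} → i ≢ j → (x : Vec Bool n) →
                       (x [ j ]≔ b) [ i ]%= not ≡ (x [ i ]%= not) [ j ]≔ b
update-commutes-flip {i = i} {j} i≢j x = updateAt-commutes i j i≢j x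

module Certificates (R : RealField) where

  open OrderedField R
  open PricedQuery R
  open Expectation R

  infixr 7 _⋆_
  _⋆_ : ∀ {n} → Restriction n → Cube n → Cube n
  π ⋆ x = zipWith (λ m b → fromMaybe b m) π x

  Agree : ∀ {n} → Restriction n → Cube n → Set
  Agree ρ x = ∀ {i b} → lookup ρ i ≡ just b → lookup x i ≡ b

  lookup-⋆ : ∀ {n} (π : Restriction n) x i → lookup (π ⋆ x) i ≡ fromMaybe (lookup x i) (lookup π i)
  lookup-⋆ π x i = lookup-zipWith _ i π x

  ⋆-agree : ∀ {n} (π : Restriction n) x → Agree π (π ⋆ x)
  ⋆-agree π x {i} eq = ≡.trans (lookup-⋆ π x i) (≡.cong (fromMaybe _) eq)

  nothing-⋆ : ∀ {n} (x : Cube n) → replicate n nothing ⋆ x ≡ x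
  nothing-⋆ []      = ≡.refl
  nothing-⋆ (b ∷ x) = ≡.cong (b ∷_) (nothing-⋆ x)

  ⋆-update : ∀ {n} (π : Restriction n) {i} b x → lookup π i ≡ nothing →
             (π [ i ]≔ just b) ⋆ x ≡ π ⋆ (x [ i ]≔ b)
  ⋆-update (nothing ∷ π) {zero}  b (_ ∷ x) eq = ≡.refl
  ⋆-update (m ∷ π)       {suc i} b (a ∷ x) eq = ≡.cong (fromMaybe a m ∷_) (⋆-update π b x eq)

  ⋆-flip-fixed : ∀ {n} (π : Restriction n) {i b} x → lookup π i ≡ just b → π ⋆ (x [ i ]%= not) ≡ π ⋆ x
  ⋆-flip-fixed (just _ ∷ π) {zero}  (_ ∷ x) eq = ≡.refl
  ⋆-flip-fixed (m ∷ π)      {suc i} (a ∷ x) eq = ≡.cong (fromMaybe a m ∷_) (⋆-flip-fixed π x eq)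

  agree-update : ∀ {n} (ρ : Restriction n) {i b x} → lookup ρ i ≡ nothing → Agree (ρ [ i ]≔ just b) x →
                 Agree ρ x × lookup x i ≡ b
  agree-update ρ {i} {b} {x} free agree = weaken , agree (lookup∘update i ρ (just b))
    where
    weaken : Agree ρ x
    weaken {j} eq with j Fin.≟ i
    ... | yes ≡.refl = ⊥-elim (just≢nothing eq free)
    ... | no j≢i     = agree (≡.trans (lookup∘update′ j≢i ρ (just b)) eq)

  update≡or≡flip : ∀ {n} (x : Cube n) i b → x [ i ]≔ b ≡ x ⊎ x [ i ]≔ b ≡ x [ i ]%= not
  update≡or≡flip (false ∷ x) zero false = inj₁ ≡.refl
  update≡or≡flip (false ∷ x) zero true  = inj₂ ≡.refl
  update≡or≡flip (true  ∷ x) zero false = inj₂ ≡.refl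
  update≡or≡flip (true  ∷ x) zero true  = inj₁ ≡.refl
  update≡or≡flip (a ∷ x) (suc i) b with update≡or≡flip x i b
  ... | inj₁ eq = inj₁ (≡.cong (a ∷_) eq)
  ... | inj₂ eq = inj₂ (≡.cong (a ∷_) eq)

  ↾-update : ∀ {n} (f : Cube n → Bool) (π : Restriction n) {i} b → lookup π i ≡ nothing →
             ∀ x → (f ↾ (π [ i ]≔ just b)) x ≡ (f ↾ π) (x [ i ]≔ b)
  ↾-update f π b free x = ≡.cong f (⋆-update π b x free)

  𝔼-⋆-split : ∀ {n} (π : Restriction n) i → lookup π i ≡ nothing → (g : Cube n → ℝ) →
              𝔼 (λ x → g (π ⋆ x)) ≈
              ½ * (𝔼 (λ x → g ((π [ i ]≔ just false) ⋆ x)) + 𝔼 (λ x → g ((π [ i ]≔ just true) ⋆ x)))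
  𝔼-⋆-split π i free g = trans (𝔼-split i (λ x → g (π ⋆ x))) (average-cong (half false) (half true))
    where
    half : ∀ b → 𝔼 (λ x → g (π ⋆ (x [ i ]≔ b))) ≈ 𝔼 (λ x → g ((π [ i ]≔ just b) ⋆ x))
    half b = 𝔼-cong-≗ λ x → ≡.cong g (≡.sym (⋆-update π b x free))

  Inf-fixed : ∀ {n} (f : Cube n → Bool) (π : Restriction n) {i b} → lookup π i ≡ just b →
              Inf i (f ↾ π) ≈ 0#
  Inf-fixed {n} f π {i} fixed = trans (𝔼-cong-≗ zero-at) (𝔼-const {n} 0#)
    where
    zero-at : ∀ x → 𝟙 ((f ↾ π) x xor (f ↾ π) (x [ i ]%= not)) ≡ 0#
    zero-at x = ≡.cong 𝟙 (≡.trans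
      (≡.cong (λ y → (f ↾ π) x xor f y) (⋆-flip-fixed π x fixed)) (xor-same (f (π ⋆ x))))

  -- Flipping bit `i` commutes with overwriting a different bit `j`, so splitting the expectation at
  -- `j` yields the influences in the two restricted functions.
  Inf-martingale : ∀ {n} (f : Cube n → Bool) (π : Restriction n) {i j} → i ≢ j → lookup π j ≡ nothing →
                   Inf i (f ↾ π) ≈
                   ½ * (Inf i (f ↾ (π [ j ]≔ just false)) + Inf i (f ↾ (π [ j ]≔ just true)))
  Inf-martingale f π {i} {j} i≢j free = trans (𝔼-split j _) (average-cong (half false) (half true))
    where
    half : ∀ b → 𝔼 (λ x → 𝟙 ((f ↾ π) (x [ j ]≔ b) xor (f ↾ π) ((x [ j ]≔ b) [ i ]%= not))) ≈
                 Inf i (f ↾ (π [ j ]≔ just b))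
    half b = 𝔼-cong-≗ λ x → ≡.cong₂ (λ u v → 𝟙 (u xor v))
      (≡.sym (↾-update f π b free x))
      (≡.trans (≡.cong (f ↾ π) (update-commutes-flip i≢j x)) (≡.sym (↾-update f π b free (x [ i ]%= not))))

  -- Certificates and the worst-case OSSS inequality.

  -- A strategy that, once the variables fixed by ρ are known, determines f at
  -- a worst-case cost of at most w.
  data Certificate {n} (f : Cube n → Bool) (c : Fin n → ℝ) (ρ : Restriction n) (w : ℝ) : Set where
    constant : ∀ b → (∀ x → Agree ρ x → f x ≡ b) → 0# ≤ w → Certificate f c ρ w
    ask      : ∀ i {w′} → lookup ρ i ≡ nothing → w′ + c i ≤ w →
               (∀ b → Certificate f c (ρ [ i ]≔ just b) w′) → Certificate f c ρ w

  certificate-nonNegative : ∀ {n} {f : Cube n → Bool} {c ρ w} → (∀ i → 0# ≤ c i) →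
                            Certificate f c ρ w → 0# ≤ w
  certificate-nonNegative 0≤c (constant _ _ 0≤w) = 0≤w
  certificate-nonNegative 0≤c (ask i _ w′+c≤w C) =
    ≤-trans (+-nonNegative (certificate-nonNegative 0≤c (C true)) (0≤c i)) w′+c≤w

  -- Induction along the certificate: `ρ` grows while `π` stays fixed, which is why the two are
  -- separate. Fixing bit `i` to `b` in `f ↾ ρ` alone is compared with fixing it in both functions;
  -- the difference is at most the influence of `i`, which `M * c i` pays for.
  bias≤error+cost : ∀ {n} {f : Cube n → Bool} {c} (π : Restriction n) {M} → 0# ≤ M →
                    (∀ i → Inf i (f ↾ π) ≤ M * c i) → ∀ {ρ w} → Certificate f c ρ w →
                    bias (f ↾ π) ≤ error (f ↾ π) (f ↾ ρ) + M * w
  bias≤error+cost {n} {f} {c} π {M} 0≤M Inf≤ {ρ} {w} (constant b const 0≤w) = begin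
    bias (f ↾ π)                    ≤⟨ bias≤error-const (f ↾ π) b ⟩
    error (f ↾ π) (λ _ → b)         ≈⟨ 𝔼-cong-≗ (λ x →
                                        ≡.cong (λ a → 𝟙 (a xor (f ↾ π) x)) (const (ρ ⋆ x) (⋆-agree ρ x))) ⟨
    error (f ↾ π) (f ↾ ρ)           ≤⟨ x≤x+y (*-nonNegative 0≤M 0≤w) ⟩
    error (f ↾ π) (f ↾ ρ) + M * w   ∎
  bias≤error+cost {n} {f} {c} π {M} 0≤M Inf≤ {ρ} {w} (ask i {w′} free w′+c≤w C) = begin
    bias k                                  ≈⟨ ½*[x+x]≈x _ ⟨
    -- The bias is bounded through either answer; averaging the two bounds lets `𝔼-split` reassemble
    -- the error for `ρ` from `D false` and `D true`.
    ½ * (bias k + bias k)                   ≤⟨ average-mono (branch false) (branch true) ⟩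
    ½ * ((D false + (Inf i k + M * w′)) + (D true + (Inf i k + M * w′)))
                                            ≈⟨ average-+ _ _ _ _ ⟩
    ½ * (D false + D true) + ½ * ((Inf i k + M * w′) + (Inf i k + M * w′))
                                            ≈⟨ +-cong (sym (𝔼-split i _)) (½*[x+x]≈x _) ⟩
    error k (f ↾ ρ) + (Inf i k + M * w′)    ≤⟨ +-monoʳ-≤ _ (+-monoˡ-≤ _ (Inf≤ i)) ⟩
    error k (f ↾ ρ) + (M * c i + M * w′)    ≈⟨ +-congˡ (trans (+-comm _ _) (sym (distribˡ M w′ (c i)))) ⟩
    error k (f ↾ ρ) + M * (w′ + c i)        ≤⟨ +-monoʳ-≤ _ (*-monoˡ-≤ 0≤M w′+c≤w) ⟩
    error k (f ↾ ρ) + M * w                 ∎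
    where
    k : Cube n → Bool
    k = f ↾ π
    D : Bool → ℝ
    D b = 𝔼 (λ x → 𝟙 ((f ↾ ρ) (x [ i ]≔ b) xor k (x [ i ]≔ b)))
    resampled : ∀ b x → 𝟙 (k (x [ i ]≔ b) xor k x) ≤ 𝟙 (k x xor k (x [ i ]%= not))
    resampled b x with update≡or≡flip x i b
    ... | inj₁ eq = ≤-trans (≤-reflexive (reflexive
                      (≡.cong 𝟙 (≡.trans (≡.cong (λ y → k y xor k x) eq) (xor-same (k x)))))) (0≤𝟙 _)
    ... | inj₂ eq = ≤-reflexive (reflexive
                      (≡.cong 𝟙 (≡.trans (≡.cong (λ y → k y xor k x) eq) (xor-comm _ (k x)))))
    branch : ∀ b → bias k ≤ D b + (Inf i k + M * w′)
    branch b = begin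
      bias k                                              ≤⟨ bias≤error+cost π 0≤M Inf≤ (C b) ⟩
      error k (f ↾ (ρ [ i ]≔ just b)) + M * w′            ≈⟨ +-congʳ (𝔼-cong-≗ λ x →
                                                               ≡.cong (λ a → 𝟙 (a xor k x)) (↾-update f ρ b free x)) ⟩
      𝔼 (λ x → 𝟙 ((f ↾ ρ) (x [ i ]≔ b) xor k x)) + M * w′ ≤⟨ +-monoˡ-≤ _ (𝔼-mono λ x →
                                                               𝟙-triangle ((f ↾ ρ) (x [ i ]≔ b)) (k (x [ i ]≔ b)) (k x)) ⟩
      𝔼 (λ x → 𝟙 ((f ↾ ρ) (x [ i ]≔ b) xor k (x [ i ]≔ b)) + 𝟙 (k (x [ i ]≔ b) xor k x)) + M * w′
                                                          ≈⟨ +-congʳ (𝔼-+ {n} _ _) ⟩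
      D b + 𝔼 (λ x → 𝟙 (k (x [ i ]≔ b) xor k x)) + M * w′ ≤⟨ +-monoˡ-≤ _ (+-monoʳ-≤ _ (𝔼-mono (resampled b))) ⟩
      D b + Inf i k + M * w′                              ≈⟨ +-assoc _ _ _ ⟩
      D b + (Inf i k + M * w′)                            ∎

  -- A worst-case form of the inequality of O'Donnell, Saks, Schramm and Servedio.
  bias≤cost : ∀ {n} {f : Cube n → Bool} {c} (π : Restriction n) {M w} → 0# ≤ M →
              (∀ i → Inf i (f ↾ π) ≤ M * c i) → Certificate f c π w → bias (f ↾ π) ≤ M * w
  bias≤cost {f = f} π 0≤M Inf≤ C = ≤-trans (bias≤error+cost π 0≤M Inf≤ C)
    (≤-trans (+-monoˡ-≤ _ (≗⇒error≤0 {f = f ↾ π} λ _ → ≡.refl)) (≤-reflexive (+-identityˡ _)))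

  -- Certificates from zero-error algorithms.

  -- Follows the tree, but a query to a variable that `ρ` already fixes is skipped, which only saves
  -- cost because costs are non-negative. Correctness is demanded only on inputs that agree with
  -- `ρ`, so the invariant passes to the branches.
  offline-certificate : ∀ {n} {f : Cube n → Bool} {c} → (∀ i → 0# ≤ c i) → (T : DecisionTree n) → ∀ {ρ w} →
                        (∀ x → Agree ρ x → eval T x ≡ f x × offlineCost c T x ≤ w) → Certificate f c ρ w
  offline-certificate 0≤c (leaf b) {ρ} correct =
    -- Any input agreeing with `ρ` will do: the cost at a leaf is 0, so its bound gives 0 ≤ w.
    constant b (λ x a → ≡.sym (proj₁ (correct x a))) (proj₂ (correct (ρ ⋆ replicate _ false) (⋆-agree ρ _)))
  offline-certificate {f = f} {c} 0≤c (query i T) {ρ} {w} correct with lookup ρ i in eq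
  ... | just b  = offline-certificate 0≤c (T b) λ x a →
    case ≡.subst (λ a → eval (T a) x ≡ f x × c i + offlineCost c (T a) x ≤ w) (a eq) (correct x a) of λ
      { (e , p) → e , ≤-trans (≤-trans (x≤x+y (0≤c i)) (≤-reflexive (+-comm _ _))) p }
  ... | nothing = ask i eq (≤-reflexive (x-y+y≈x w (c i))) λ b → offline-certificate 0≤c (T b) λ x a →
    case agree-update ρ {x = x} eq a of λ
      { (a′ , xᵢ≡b) →
        case ≡.subst (λ a → eval (T a) x ≡ f x × c i + offlineCost c (T a) x ≤ w) xᵢ≡b (correct x a′) of λ
          { (e , p) → e , x+y≤z⇒x≤z-y (≤-trans (≤-reflexive (+-comm _ _)) p) } }

  investment-nonNegative : ∀ {n} {β} → 0# ≤ β → ∀ (h : History n) i → 0# ≤ investment β h i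
  investment-nonNegative 0≤β []            i = ≤-refl
  investment-nonNegative 0≤β ((j , _) ∷ h) i with i Fin.≟ j
  ... | yes _ = +-nonNegative (investment-nonNegative 0≤β h i) 0≤β
  ... | no _  = investment-nonNegative 0≤β h i

  investment-increasing : ∀ {n} {β} → 0# ≤ β → ∀ (h : History n) a i → investment β h i ≤ investment β (a ∷ h) i
  investment-increasing 0≤β h (j , _) i with i Fin.≟ j
  ... | yes _ = x≤x+y 0≤β
  ... | no _  = ≤-refl

  response-just : ∀ {n} {c : Fin n → ℝ} {β} x {h i} → c i ≤ investment β h i + β →
                  response c β x h i ≡ just (lookup x i)
  response-just {c = c} {β} x {h} {i} p with c i ≤? (investment β h i + β)
  ... | yes _ = ≡.refl
  ... | no ¬p = ⊥-elim (¬p p)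

  response-nothing : ∀ {n} {c : Fin n → ℝ} {β} x {h i} → ¬ c i ≤ investment β h i + β →
                     response c β x h i ≡ nothing
  response-nothing {c = c} {β} x {h} {i} ¬p with c i ≤? (investment β h i + β)
  ... | yes p = ⊥-elim (¬p p)
  ... | no _  = ≡.refl

  module _ {n} {A : OnlineAlgorithm n} {c : Fin n → ℝ} {β : ℝ} where

    runLength : ∀ {x h h′ b} → Run A c β x h h′ b → ℕ
    runLength (stop _)     = 0
    runLength (step _ _ r) = suc (runLength r)

    run-halt : ∀ {x h h′ a b} → A h ≡ halt a → Run A c β x h h′ b → h′ ≡ h × b ≡ a
    run-halt Ah (stop Ah′)     with ≡.refl ← ≡.trans (≡.sym Ah) Ah′ = ≡.refl , ≡.refl
    run-halt Ah (step _ Ah′ _) with () ← ≡.trans (≡.sym Ah) Ah′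

    run-invest : ∀ {x h h′ b i} → A h ≡ invest i → (r : Run A c β x h h′ b) →
                 Σ[ r′ ∈ Run A c β x ((i , response c β x h i) ∷ h) h′ b ] runLength r ≡ suc (runLength r′)
    run-invest Ah (stop Ah′)     with () ← ≡.trans (≡.sym Ah) Ah′
    run-invest Ah (step i Ah′ r) with ≡.refl ← ≡.trans (≡.sym Ah) Ah′ = r , ≡.refl

    -- The step bound `N` is common to all inputs, so that `online-certificate` can recurse on it.
    GoodRun : (Cube n → Bool) → ℝ → ℕ → History n → Cube n → Set
    GoodRun f W N h x = ∃₂ λ h′ b → Σ[ r ∈ Run A c β x h h′ b ]
      (runLength r ℕ.≤ N × b ≡ f x × sum (investment β h′) ≤ W)

    goodRun-invest : ∀ {f W N h x i} → A h ≡ invest i → GoodRun f W (suc N) h x →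
                     GoodRun f W N ((i , response c β x h i) ∷ h) x
    goodRun-invest Ah (h′ , b , r , l , q) with run-invest Ah r
    ... | r′ , eq = h′ , b , r′ , ℕ.s≤s⁻¹ (≡.subst (ℕ._≤ _) eq l) , q

    -- t records the costs of the variables asked about so far; these are
    -- covered by the investments in h.
    online-certificate : ∀ {f W} → 0# ≤ β → ∀ N {h ρ w} (t : Fin n → ℝ) →
                         (∀ x → Agree ρ x → GoodRun f W N h x) →
                         (∀ i → t i ≤ investment β h i) → (∀ i → lookup ρ i ≡ nothing → t i ≤ 0#) →
                         W ≤ w + sum t → Certificate f c ρ w
    online-certificate {f} {W} 0≤β N {h} {ρ} {w} t runs t≤θ t≤0 W≤ with A h in Ah
    online-certificate {f} {W} 0≤β N {h} {ρ} {w} t runs t≤θ t≤0 W≤ | halt a =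
      constant a value (+-cancelʳ-≤ (sum t) (begin
        0# + sum t           ≈⟨ +-identityˡ _ ⟩
        sum t                ≤⟨ sum-mono-≤ t≤θ ⟩
        sum (investment β h) ≤⟨ spent≤W ⟩
        W                    ≤⟨ W≤ ⟩
        w + sum t            ∎))
      where
      value : ∀ x → Agree ρ x → f x ≡ a
      value x agree with runs x agree
      ... | _ , _ , r , _ , b≡fx , _ = ≡.trans (≡.sym b≡fx) (proj₂ (run-halt Ah r))
      spent≤W : sum (investment β h) ≤ W
      spent≤W with runs (ρ ⋆ replicate _ false) (⋆-agree ρ _)
      ... | _ , _ , r , _ , _ , p with ≡.refl ← proj₁ (run-halt Ah r) = p
    online-certificate {f} {W} 0≤β zero {h} {ρ} {w} t runs t≤θ t≤0 W≤ | invest i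
      with runs (ρ ⋆ replicate _ false) (⋆-agree ρ _)
    ... | _ , _ , r , l , _ with () ← ≡.subst (ℕ._≤ 0) (proj₂ (run-invest Ah r)) l
    online-certificate {f} {W} 0≤β (suc N) {h} {ρ} {w} t runs t≤θ t≤0 W≤ | invest i
      with c i ≤? (investment β h i + β)
    -- Nothing is revealed on any input, so there is nothing to ask; only the investments grow.
    ... | no ¬p = online-certificate 0≤β N t
      (λ x a → ≡.subst (λ r → GoodRun f W N ((i , r) ∷ h) x) (response-nothing {c = c} x {h} ¬p)
                 (goodRun-invest {f} Ah (runs x a)))
      (λ j → ≤-trans (t≤θ j) (investment-increasing 0≤β h (i , nothing) j)) t≤0 W≤
    ... | yes p with lookup ρ i in eq
    -- A bit that `ρ` already fixes is revealed with the same value on all agreeing inputs and is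
    -- not charged.
    ...   | just b = online-certificate 0≤β N t
      (λ x a → ≡.subst (λ r → GoodRun f W N ((i , r) ∷ h) x)
                 (≡.trans (response-just {c = c} x {h} p) (≡.cong just (a eq))) (goodRun-invest {f} Ah (runs x a)))
      (λ j → ≤-trans (t≤θ j) (investment-increasing 0≤β h (i , nothing) j)) t≤0 W≤
    -- The first time `i` becomes known: `c i` leaves the budget `w` and enters `t`, where the
    -- investment just made covers it.
    ...   | nothing = ask i eq (≤-reflexive (x-y+y≈x w (c i))) λ b → online-certificate 0≤β N t′
      (λ x a → case agree-update ρ {x = x} eq a of λ { (a′ , xᵢ≡b) →
        ≡.subst (λ r → GoodRun f W N ((i , r) ∷ h) x)
          (≡.trans (response-just {c = c} x {h} p) (≡.cong just xᵢ≡b)) (goodRun-invest {f} Ah (runs x a′)) })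
      (t′≤θ b) (t′≤0 b) W≤′
      where
      t′ : Fin n → ℝ
      t′ j = if does (j Fin.≟ i) then c i else t j
      t′≤θ : ∀ b j → t′ j ≤ investment β ((i , just b) ∷ h) j
      t′≤θ b j with j Fin.≟ i
      ... | yes ≡.refl = p
      ... | no _       = t≤θ j
      t′≤0 : ∀ b j → lookup (ρ [ i ]≔ just b) j ≡ nothing → t′ j ≤ 0#
      t′≤0 b j free with j Fin.≟ i
      ... | yes ≡.refl = ⊥-elim (just≢nothing (lookup∘update i ρ (just b)) free)
      ... | no j≢i     = t≤0 j (≡.trans (≡.sym (lookup∘update′ j≢i ρ (just b))) free)
      tᵢ+c≤t′ᵢ : t i + c i ≤ t′ i
      tᵢ+c≤t′ᵢ with i Fin.≟ i
      ... | yes _  = ≤-trans (+-monoˡ-≤ (c i) (t≤0 i eq)) (≤-reflexive (+-identityˡ _))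
      ... | no i≢i = ⊥-elim (i≢i ≡.refl)
      t≤t′ : ∀ j → j ≢ i → t j ≤ t′ j
      t≤t′ j j≢i with j Fin.≟ i
      ... | yes j≡i = ⊥-elim (j≢i j≡i)
      ... | no _    = ≤-refl
      W≤′ : W ≤ w - c i + sum t′
      W≤′ = begin
        W                       ≤⟨ W≤ ⟩
        w + sum t               ≈⟨ +-congʳ (x-y+y≈x w (c i)) ⟨
        w - c i + c i + sum t   ≈⟨ solve 3 (λ a b d → (a :+ b) :+ d := a :+ (d :+ b)) refl _ _ _ ⟩
        w - c i + (sum t + c i) ≤⟨ +-monoʳ-≤ _ (sum-mono-≤-at i tᵢ+c≤t′ᵢ t≤t′) ⟩
        w - c i + sum t′        ∎

  Cube-bounded : ∀ {n} (g : Cube n → ℕ) → ∃ λ N → ∀ x → g x ℕ.≤ N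
  Cube-bounded {zero}  g = g [] , λ { [] → ℕ.≤-refl }
  Cube-bounded {suc n} g with Cube-bounded (g ∘ (false ∷_)) | Cube-bounded (g ∘ (true ∷_))
  ... | N₀ , p₀ | N₁ , p₁ = N₀ ℕ.⊔ N₁ , λ
    { (false ∷ x) → ℕ.≤-trans (p₀ x) (ℕ.m≤m⊔n N₀ N₁)
    ; (true  ∷ x) → ℕ.≤-trans (p₁ x) (ℕ.m≤n⊔m N₀ N₁) }

  -- A zero-error algorithm is correct on every input, in particular on those that agree with `π`;
  -- the variables fixed by `π` then cost nothing.
  zeroError-certificate : ∀ {n} {f : Cube n → Bool} {c w} → (∀ i → 0# ≤ c i) →
                          ZeroErrorWorstCost f c w → ∀ π → Certificate f c π w
  zeroError-certificate {f = f} {c} 0≤c (offline T err w≈) π = offline-certificate 0≤c T λ x _ →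
    error≤0⇒≗ {f = f} {g = eval T} err x ,
    ≤-trans (x≤maximum (offlineCost c T) x) (≤-reflexive (sym w≈))
  zeroError-certificate {n} {f} {c} {w} 0≤c (online β 0<β A H err w≈) π =
    online-certificate (proj₁ 0<β) (proj₁ bounded) (λ _ → 0#)
      (λ x _ → proj₁ (H x) , output H x , proj₂ (proj₂ (H x)) , proj₂ bounded x ,
        error≤0⇒≗ {f = f} {g = output H} err x ,
        ≤-trans (x≤maximum (onlineCost H) x) (≤-reflexive (sym w≈)))
      (λ _ → ≤-refl) (λ _ _ → ≤-refl)
      (x≤x+y (sum-nonNegative {n} (λ _ → ≤-refl)))
    where
    bounded = Cube-bounded (λ x → runLength (proj₂ (proj₂ (H x))))

  shift : ∀ {n} → DecisionTree n → DecisionTree (suc n)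
  shift (leaf b)    = leaf b
  shift (query i T) = query (suc i) (shift ∘ T)

  eval-shift : ∀ {n} (T : DecisionTree n) b x → eval (shift T) (b ∷ x) ≡ eval T x
  eval-shift (leaf _)    b x = ≡.refl
  eval-shift (query i T) b x = eval-shift (T (lookup x i)) b x

  fullTree : ∀ {n} → (Cube n → Bool) → DecisionTree n
  fullTree {zero}  f = leaf (f [])
  fullTree {suc n} f = query zero λ b → shift (fullTree (f ∘ (b ∷_)))

  eval-fullTree : ∀ {n} (f : Cube n → Bool) x → eval (fullTree f) x ≡ f x
  eval-fullTree f []      = ≡.refl
  eval-fullTree f (b ∷ x) = ≡.trans (eval-shift (fullTree (f ∘ (b ∷_))) b x) (eval-fullTree (f ∘ (b ∷_)) x)

  zeroError-exists : ∀ {n} (f : Cube n → Bool) c → ∃ (ZeroErrorWorstCost f c)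
  zeroError-exists f c = _ , offline (fullTree f) (≗⇒error≤0 {f = f} (eval-fullTree f)) refl

-- Existence of the algorithm and comparison of ratios.

sum-decrement : ∀ {n} (v : Vec ℕ n) {i r} → lookup v i ≡ suc r → suc (Vec.sum (v [ i ]≔ r)) ≡ Vec.sum v
sum-decrement (_ ∷ v) {zero}  ≡.refl = ≡.refl
sum-decrement (k ∷ v) {suc i} eq     =
  ≡.trans (≡.sym (ℕ.+-suc k _)) (≡.cong (k ℕ.+_) (sum-decrement v eq))

sum-decrement-≤ : ∀ {n} (v : Vec ℕ n) {i r k} → lookup v i ≡ suc r → Vec.sum v ℕ.≤ suc k →
                  Vec.sum (v [ i ]≔ r) ℕ.≤ k
sum-decrement-≤ v eq v≤ = ℕ.s≤s⁻¹ (≡.subst (ℕ._≤ _) (≡.sym (sum-decrement v eq)) v≤)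

module Warmup (R : RealField) where

  open OrderedField R
  open PricedQuery R
  open Expectation R
  open Certificates R
  open AddSupremum _≤_ using (_≤⁺_; _≤⊤⁺; ≤⁺-trans; ≤⁺-total)
    renaming ([_] to [_]≤)

  ≤⁺-refl : ∀ r → r ≤⁺ r
  ≤⁺-refl [ _ ] = [ ≤-refl ]≤
  ≤⁺-refl ⊤⁺    = ⊤⁺ ≤⊤⁺

  argmax : ∀ {n} (r : Fin (suc n) → ℝ ⁺) → ∃ (_∈argmax r)
  argmax {zero}  r = zero , λ { zero → ≤⁺-refl (r zero) }
  argmax {suc n} r with argmax (r ∘ suc)
  ... | i , max with ≤⁺-total ≤-total (r zero) (r (suc i))
  ...   | inj₁ p = suc i , λ { zero → p ; (suc j) → max j }
  ...   | inj₂ p = zero , λ { zero → ≤⁺-refl (r zero) ; (suc j) → ≤⁺-trans ≤-trans (max j) p }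

  warmup : ∀ {n} (f : Cube n → Bool) {ε} β → 0# < ε → ∀ h → ∃ (WarmupStep f ε β h)
  warmup {n} f {ε} β 0<ε h with bias (f ↾ revealed h) ≤? ε
  ... | yes p = _ , finish p
  -- Without variables there is no argmax, but the function is then constant and has bias 0, so the
  -- loop cannot continue.
  warmup {zero} f {ε} β 0<ε h | no ¬p = ⊥-elim (¬p (begin
    bias g                  ≤⟨ bias≤error-const g (g []) ⟩
    error g (λ _ → g [])    ≤⟨ ≗⇒error≤0 {f = g} {λ _ → g []} (λ { [] → ≡.refl }) ⟩
    0#                      ≤⟨ proj₁ 0<ε ⟩
    ε                       ∎))
    where
    g : Cube 0 → Bool
    g = f ↾ revealed h
  warmup {suc n} f {ε} β 0<ε h | no ¬p =
    let i , max = argmax (λ j → Inf j (f ↾ revealed h) ÷ investment β h j)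
    in _ , continue (≰⇒≥ ¬p , λ ε≈ → ¬p (≤-reflexive (sym ε≈))) i max

  -- A finite bound excludes the quotient `⊤⁺`, so `θ ≈ 0#` leaves only 0/0, where `p` itself is 0.
  ÷≤⇒≤* : ∀ {p θ r} → 0# ≤ θ → (p ÷ θ) ≤⁺ [ r ] → p ≤ r * θ
  ÷≤⇒≤* {p} {θ} {r} 0≤θ q with θ ≟ 0#
  ... | no θ≉0 with [ q′ ]≤ ← q = x*y⁻¹≤z⇒x≤z*y (≥∧≉⇒> 0≤θ θ≉0) q′
  ... | yes θ≈0 with p ≟ 0# | q
  ...   | yes p≈0 | _ = ≤-reflexive (trans p≈0 (sym (trans (*-congˡ θ≈0) (zeroʳ r))))
  ...   | no _    | ()

  -- The investment in the chosen variable.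

  module _ {n} (f : Cube n → Bool) (c : Fin n → ℝ) {ε β : ℝ}
           (0≤c : ∀ i → 0# ≤ c i) (0<ε : 0# < ε) (0<β : 0# < β) where

    private
      0≤β : 0# ≤ β
      0≤β = proj₁ 0<β

    0≤w*ε⁻¹ : ∀ {π w} → Certificate f c π w → 0# ≤ w * ε ⁻¹
    0≤w*ε⁻¹ C = *-nonNegative (certificate-nonNegative 0≤c C) (⁻¹-nonNegative 0<ε)

    -- The inequality is not strict, because a bit of cost 0 is still hidden before the first
    -- investment in it.
    Affordable : History n → Set
    Affordable h = ∀ i → lookup (revealed h) i ≡ nothing → investment β h i ≤ c i

    -- A common bound `r` on the ratios can serve as `M` in `bias≤cost`: hidden variables have θⱼ ≤
    -- cⱼ, and fixed ones have influence 0.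
    ratio-bound : ∀ {h} → Affordable h → ∀ {r} → 0# ≤ r →
                  (∀ j → (Inf j (f ↾ revealed h) ÷ investment β h j) ≤⁺ [ r ]) →
                  ε < bias (f ↾ revealed h) →
                  ∀ {w} → Certificate f c (revealed h) w → ε < r * w
    ratio-bound {h} affordable {r} 0≤r ≤r ε<bias C = <-≤-trans ε<bias (bias≤cost (revealed h) 0≤r Inf≤ C)
      where
      Inf≤ : ∀ j → Inf j (f ↾ revealed h) ≤ r * c j
      Inf≤ j with lookup (revealed h) j in eq
      ... | just _  = ≤-trans (≤-reflexive (Inf-fixed f (revealed h) eq)) (*-nonNegative 0≤r (0≤c j))
      ... | nothing = ≤-trans (÷≤⇒≤* (investment-nonNegative 0≤β h j) (≤r j)) (*-monoˡ-≤ 0≤r (affordable j eq))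

    ε≮0*w : ∀ {r w} → r ≈ 0# → ¬ ε < r * w
    ε≮0*w {r} {w} r≈0 ε<rw = <-irrefl (<-≤-trans 0<ε (≤-trans (proj₁ ε<rw)
      (≤-reflexive (trans (*-congʳ r≈0) (zeroˡ w)))))

    -- Applied with M = Inf i / θᵢ for the chosen i, the worst-case OSSS
    -- inequality turns into a bound on θᵢ.
    chosen : ∀ {h i} → Affordable h → ε < bias (f ↾ revealed h) →
             i ∈argmax (λ j → Inf j (f ↾ revealed h) ÷ investment β h j) →
             ∀ {w} → Certificate f c (revealed h) w →
             lookup (revealed h) i ≡ nothing × investment β h i ≤ w * ε ⁻¹ * Inf i (f ↾ revealed h)
    chosen {h} {i} affordable ε<bias max {w} C with investment β h i ≟ 0#
    ... | yes θ≈0 with Inf i (f ↾ revealed h) ≟ 0#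
    -- The largest ratio is 0/0 = 0, which would force the bias down to 0.
    ...   | yes _  = ⊥-elim (ε≮0*w refl (ratio-bound {h} affordable ≤-refl max ε<bias C))
    ...   | no p≉0 = free , (begin
      investment β h i                    ≈⟨ θ≈0 ⟩
      0#                                  ≤⟨ *-nonNegative
                                               (0≤w*ε⁻¹ C)
                                               (Inf-nonNegative i (f ↾ revealed h)) ⟩
      w * ε ⁻¹ * Inf i (f ↾ revealed h)   ∎)
      where
      free : lookup (revealed h) i ≡ nothing
      free with lookup (revealed h) i in eq
      ... | nothing = ≡.refl
      ... | just _  = ⊥-elim (p≉0 (Inf-fixed f (revealed h) eq))
    chosen {h} {i} affordable ε<bias max {w} C | no θ≉0 = free , θ≤
      where
      p θ : ℝ
      p = Inf i (f ↾ revealed h)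
      θ = investment β h i
      0<θ : 0# < θ
      0<θ = ≥∧≉⇒> (investment-nonNegative 0≤β h i) θ≉0
      ε<pθ⁻¹w : ε < p * θ ⁻¹ * w
      ε<pθ⁻¹w = ratio-bound {h} affordable
        (*-nonNegative (Inf-nonNegative i (f ↾ revealed h)) (⁻¹-nonNegative 0<θ)) max ε<bias C
      free : lookup (revealed h) i ≡ nothing
      -- A fixed variable has influence 0, so the largest ratio would again be 0.
      free with lookup (revealed h) i in eq
      ... | nothing = ≡.refl
      ... | just _  = ⊥-elim (ε≮0*w (trans (*-congʳ (Inf-fixed f (revealed h) eq)) (zeroˡ _)) ε<pθ⁻¹w)
      θ≤ : θ ≤ w * ε ⁻¹ * p
      θ≤ = begin
        θ             ≤⟨ x*y≤z⇒x≤z*y⁻¹ 0<ε (begin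
          θ * ε       ≈⟨ *-comm θ ε ⟩
          ε * θ       ≤⟨ x≤y*z⁻¹⇒x*z≤y 0<θ (≤-trans (proj₁ ε<pθ⁻¹w)
                           (≤-reflexive (solve 3 (λ p t w → (p :* t) :* w := (p :* w) :* t) refl p (θ ⁻¹) w))) ⟩
          p * w       ∎) ⟩
        p * w * ε ⁻¹  ≈⟨ solve 3 (λ p w e → (p :* w) :* e := (w :* e) :* p) refl p w (ε ⁻¹) ⟩
        w * ε ⁻¹ * p  ∎

    -- The tree of runs.

    module _ {A : OnlineAlgorithm n} (warm : IsWarmupIPRR f ε β A) where

      -- Quantified over `w`, so that one tree of runs can be compared with every zero-error
      -- algorithm before the infimum is taken.
      Charged : History n → Fin n → Set
      Charged h i = ∀ {w} → Certificate f c (revealed h) w →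
                    investment β h i ≤ w * ε ⁻¹ * Inf i (f ↾ revealed h)

      -- All runs from `h` at once. Whether an investment reveals its bit depends on the costs and
      -- not on the input, so branching occurs only at revelations. Expectations are then computed
      -- by induction on the tree.
      data Computation (h : History n) : Set where
        halted    : bias (f ↾ revealed h) ≤ ε → A h ≡ halt (does (½ ≤? Pr (f ↾ revealed h))) → Computation h
        waiting   : ∀ i → A h ≡ invest i → Charged h i → ¬ c i ≤ investment β h i + β →
                    Computation ((i , nothing) ∷ h) → Computation h
        revealing : ∀ i → A h ≡ invest i → Charged h i → c i ≤ investment β h i + β →
                    lookup (revealed h) i ≡ nothing →
                    (∀ b → Computation ((i , just b) ∷ h)) → Computation h

      final : ∀ {h} → Computation h → Cube n → History n
      final {h} (halted _ _)             x = h
      final     (waiting _ _ _ _ t)      x = final t x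
      final     (revealing i _ _ _ _ ts) x = final (ts (lookup x i)) x

      answer : ∀ {h} → Computation h → Cube n → Bool
      answer {h} (halted _ _)             x = does (½ ≤? Pr (f ↾ revealed h))
      answer     (waiting _ _ _ _ t)      x = answer t x
      answer     (revealing i _ _ _ _ ts) x = answer (ts (lookup x i)) x

      run : ∀ {h} (t : Computation h) x → Run A c β x h (final t x) (answer t x)
      run (halted _ Ah)                  x = stop Ah
      run {h} (waiting i Ah _ ¬p t)      x = step i Ah
        (≡.subst (λ r → Run A c β x ((i , r) ∷ h) (final t x) (answer t x))
          (≡.sym (response-nothing {c = c} x {h} ¬p)) (run t x))
      run {h} (revealing i Ah _ p _ ts)  x = step i Ah
        (≡.subst (λ r → Run A c β x ((i , r) ∷ h) (final (ts (lookup x i)) x) (answer (ts (lookup x i)) x))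
          (≡.sym (response-just {c = c} x {h} p)) (run (ts (lookup x i)) x))

      -- Expected error and expected investments.

      -- Given the bits in `π`, a free bit is a fair coin; in the half that fixes it to `b`, reading
      -- it back gives `b`, so the bound for that branch applies.
      reveal-bound : ∀ {π i} → lookup π i ≡ nothing → ∀ (g : Bool → Cube n → ℝ) {u : Bool → ℝ} →
                     (∀ b → 𝔼 (λ x → g b ((π [ i ]≔ just b) ⋆ x)) ≤ u b) →
                     𝔼 (λ x → g (lookup (π ⋆ x) i) (π ⋆ x)) ≤ ½ * (u false + u true)
      reveal-bound {π} {i} free g {u} bound =
        ≤-trans (≤-reflexive (𝔼-⋆-split π i free λ y → g (lookup y i) y)) (average-mono (half false) (half true))
        where
        half : ∀ b → 𝔼 (λ x → g (lookup ((π [ i ]≔ just b) ⋆ x) i) ((π [ i ]≔ just b) ⋆ x)) ≤ u b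
        half b = ≤-trans (≤-reflexive (𝔼-cong-≗ λ x →
          ≡.cong (λ a → g a ((π [ i ]≔ just b) ⋆ x))
            (⋆-agree (π [ i ]≔ just b) x (lookup∘update i π (just b))))) (bound b)

      -- Conditioned on a halting history the error is at most the bias, hence at most `ε`, and
      -- averaging over revealed bits preserves this.
      answer-error : ∀ {h} (t : Computation h) →
                     𝔼 (λ x → 𝟙 (answer t (revealed h ⋆ x) xor f (revealed h ⋆ x))) ≤ ε
      answer-error {h} (halted bias≤ε _) = ≤-trans (error-majority≤bias (f ↾ revealed h)) bias≤ε
      answer-error (waiting _ _ _ _ t) = answer-error t
      answer-error {h} (revealing i _ _ _ free ts) = ≤-trans
        (reveal-bound free (λ b y → 𝟙 (answer (ts b) y xor f y)) (λ b → answer-error (ts b)))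
        (≤-reflexive (½*[x+x]≈x ε))

      -- m is the largest influence of i so far.  As long as i is hidden its
      -- influence is a martingale, so that m + Inf i * L m decreases in
      -- expectation: this is Doob's maximal inequality integrated over all levels.
      investment-bound : ∀ {h} (t : Computation h) i {w m} → (∀ π → Certificate f c π w) →
                         Inf i (f ↾ revealed h) ≤ m → m ≤ 1# →
                         investment β h i ≤ β + w * ε ⁻¹ * m →
                         𝔼 (λ x → investment β (final t (revealed h ⋆ x)) i) ≤
                         β + w * ε ⁻¹ * (m + Inf i (f ↾ revealed h) * L m)
      investment-bound {h} (halted _ _) i {w} {m} C p≤m m≤1 θ≤ = begin
        𝔼 {n} (λ _ → investment β h i)      ≈⟨ 𝔼-const {n} _ ⟩
        investment β h i                    ≤⟨ θ≤ ⟩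
        β + w * ε ⁻¹ * m                    ≤⟨ +-monoʳ-≤ β (*-monoˡ-≤
                                                 (0≤w*ε⁻¹ (C (revealed h)))
                                                 (x≤x+y (0≤p*Lm (Inf-nonNegative i (f ↾ revealed h)) p≤m m≤1))) ⟩
        β + w * ε ⁻¹ * (m + Inf i (f ↾ revealed h) * L m) ∎
      investment-bound {h} (waiting j _ charged _ t) i {w} {m} C p≤m m≤1 θ≤ =
        investment-bound t i C p≤m m≤1 θ′≤
        where
        θ′≤ : investment β ((j , nothing) ∷ h) i ≤ β + w * ε ⁻¹ * m
        θ′≤ with i Fin.≟ j
        ... | no _       = θ≤
        -- The charge bounds θᵢ as it was before this investment; the summand `β` of the bound
        -- absorbs the investment itself.
        ... | yes ≡.refl = begin
          investment β h i + β                   ≈⟨ +-comm _ β ⟩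
          β + investment β h i                   ≤⟨ +-monoʳ-≤ β (charged (C (revealed h))) ⟩
          β + w * ε ⁻¹ * Inf i (f ↾ revealed h)  ≤⟨ +-monoʳ-≤ β (*-monoˡ-≤
                                                      (0≤w*ε⁻¹ (C (revealed h))) p≤m) ⟩
          β + w * ε ⁻¹ * m                       ∎
      investment-bound {h} (revealing j _ charged _ free ts) i {w} {m} C p≤m m≤1 θ≤ = begin
        𝔼 (λ x → investment β (final (ts (lookup (π ⋆ x) j)) (π ⋆ x)) i)
          ≤⟨ reveal-bound free (λ b y → investment β (final (ts b) y) i) branch ⟩
        ½ * ((β + K * (m + q false * L m)) + (β + K * (m + q true * L m)))
          ≈⟨ average-+ _ _ _ _ ⟩
        ½ * (β + β) + ½ * (K * (m + q false * L m) + K * (m + q true * L m))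
          ≈⟨ +-cong (½*[x+x]≈x β) (solve 6 (λ h k m a b l →
               h :* (k :* (m :+ a :* l) :+ k :* (m :+ b :* l)) := k :* (h :* (m :+ m) :+ (h :* (a :+ b)) :* l))
               refl ½ K m (q false) (q true) (L m)) ⟩
        β + K * (½ * (m + m) + ½ * (q false + q true) * L m)
          ≈⟨ +-congˡ (*-congˡ (+-congʳ (½*[x+x]≈x m))) ⟩
        β + K * (m + ½ * (q false + q true) * L m)
          ≤⟨ +-monoʳ-≤ β (*-monoˡ-≤ 0≤K (+-monoʳ-≤ m supermartingale)) ⟩
        β + K * (m + Inf i (f ↾ π) * L m) ∎
        where
        π : Restriction n
        π = revealed h
        K : ℝ
        K = w * ε ⁻¹
        0≤K : 0# ≤ K
        0≤K = 0≤w*ε⁻¹ (C π)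
        q : Bool → ℝ
        q b = Inf i (f ↾ (π [ j ]≔ just b))
        0≤q : ∀ b → 0# ≤ q b
        0≤q b = Inf-nonNegative i (f ↾ (π [ j ]≔ just b))
        average≤ : ½ * (q false + q true) ≈ 0# ⊎ ½ * (q false + q true) ≈ Inf i (f ↾ π)
        -- Revealing `i` itself sends its influence to 0, which turns the martingale into a
        -- supermartingale.
        average≤ with i Fin.≟ j
        ... | no i≢j     = inj₂ (sym (Inf-martingale f π i≢j free))
        ... | yes ≡.refl = inj₁ (trans (average-cong (q≈0 false) (q≈0 true)) (½*[x+x]≈x 0#))
          where
          q≈0 : ∀ b → q b ≈ 0#
          q≈0 b = Inf-fixed f (π [ i ]≔ just b) (lookup∘update i π (just b))
        supermartingale : ½ * (q false + q true) * L m ≤ Inf i (f ↾ π) * L m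
        supermartingale with average≤
        ... | inj₁ eq = ≤-trans (≤-reflexive (trans (*-congʳ eq) (zeroˡ _))) (0≤p*Lm (Inf-nonNegative i (f ↾ π)) p≤m m≤1)
        ... | inj₂ eq = ≤-reflexive (*-congʳ eq)
        q≤p+p : ∀ b → q b ≤ Inf i (f ↾ π) + Inf i (f ↾ π)
        q≤p+p b = begin
          q b                                         ≤⟨ q≤sum b ⟩
          q false + q true                            ≈⟨ ½*[x+x]≈x _ ⟨
          ½ * ((q false + q true) + (q false + q true)) ≈⟨ distribˡ ½ _ _ ⟩
          ½ * (q false + q true) + ½ * (q false + q true) ≤⟨ +-mono-≤ avg≤p avg≤p ⟩
          Inf i (f ↾ π) + Inf i (f ↾ π)               ∎
          where
          q≤sum : ∀ b → q b ≤ q false + q true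
          q≤sum false = x≤x+y (0≤q true)
          q≤sum true  = ≤-trans (x≤x+y (0≤q false)) (≤-reflexive (+-comm _ _))
          avg≤p : ½ * (q false + q true) ≤ Inf i (f ↾ π)
          avg≤p with average≤
          ... | inj₁ eq = ≤-trans (≤-reflexive eq) (Inf-nonNegative i (f ↾ π))
          ... | inj₂ eq = ≤-reflexive eq
        new-maximum : ∀ b → m ≤ q b → q b + q b * L (q b) ≤ m + q b * L m
        new-maximum b m≤q with m ≟ 0#
        ... | no m≉0  = L-step (≥∧≉⇒> (≤-trans (Inf-nonNegative i (f ↾ π)) p≤m) m≉0) m≤q (Inf≤1 i (f ↾ (π [ j ]≔ just b)))
        -- `L-step` needs a positive `m`. If `m` is 0, so is the current influence, and `q≤p+p`
        -- forces the next one to be 0 as well.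
        ... | yes m≈0 = begin
          q b + q b * L (q b) ≈⟨ +-cong q≈0 (trans (*-congʳ q≈0) (zeroˡ _)) ⟩
          0# + 0#             ≈⟨ +-cong m≈0 (trans (*-congʳ q≈0) (zeroˡ _)) ⟨
          m + q b * L m       ∎
          where
          q≈0 : q b ≈ 0#
          q≈0 = ≤-antisym (≤-trans (q≤p+p b) (≤-trans (+-mono-≤ p≤m p≤m)
            (≤-reflexive (trans (+-cong m≈0 m≈0) (+-identityˡ 0#))))) (0≤q b)
        θ′≤ : ∀ b → investment β ((j , just b) ∷ h) i ≤ β + K * m
        θ′≤ b with i Fin.≟ j
        ... | no _       = θ≤
        ... | yes ≡.refl = begin
          investment β h i + β     ≈⟨ +-comm _ β ⟩
          β + investment β h i     ≤⟨ +-monoʳ-≤ β (charged (C π)) ⟩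
          β + K * Inf i (f ↾ π)    ≤⟨ +-monoʳ-≤ β (*-monoˡ-≤ 0≤K p≤m) ⟩
          β + K * m                ∎
        branch : ∀ b → 𝔼 (λ x → investment β (final (ts b) ((π [ j ]≔ just b) ⋆ x)) i) ≤ β + K * (m + q b * L m)
        branch b with ≤-total (q b) m
        ... | inj₁ q≤m = investment-bound (ts b) i C q≤m m≤1 (θ′≤ b)
        -- The maximum rises to `q b`; by `new-maximum` the potential taken at the new maximum is at
        -- most that at the old `m`.
        ... | inj₂ m≤q = ≤-trans
          (investment-bound (ts b) i C ≤-refl (Inf≤1 i (f ↾ (π [ j ]≔ just b)))
            (≤-trans (θ′≤ b) (+-monoʳ-≤ β (*-monoˡ-≤ 0≤K m≤q))))
          (+-monoʳ-≤ β (*-monoˡ-≤ 0≤K (new-maximum b m≤q)))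

      -- Termination.

      -- v i bounds the number of further investments that can be made in a hidden i.
      Pending : History n → Vec ℕ n → Set
      Pending h v = ∀ i → lookup (revealed h) i ≡ nothing →
                    Σ[ r ∈ ℕ ] lookup v i ≡ suc r × c i ≤ investment β h i + suc r · β

      -- Recursion on `k`, which bounds the total of the counters: by `chosen` every investment goes
      -- to a hidden variable, and it lowers the counter of that variable.
      computation : ∀ k {h} v → Vec.sum v ℕ.≤ k → Affordable h → Pending h v → Computation h
      computation k {h} v v≤k affordable pending with A h in Ah | warm h
      ... | _ | finish bias≤ε = halted bias≤ε Ah
      ... | _ | continue ε<bias i max
        -- Any zero-error algorithm serves here, since only the freeness of `i` is extracted.
        with free ← proj₁ (chosen {h} affordable ε<bias max
          (zeroError-certificate 0≤c (proj₂ (zeroError-exists f c)) (revealed h)))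
        with pending i free
      ...   | r , vᵢ≡ , cᵢ≤ with k
      ...     | zero with () ← ≡.subst (ℕ._≤ 0) (≡.sym (sum-decrement v vᵢ≡)) v≤k
      ...     | suc k′ with c i ≤? (investment β h i + β)
      ...       | yes p = revealing i Ah (λ C → proj₂ (chosen {h} affordable ε<bias max C)) p free λ b →
        computation k′ (v [ i ]≔ r) (sum-decrement-≤ v vᵢ≡ v≤k) (affordable′ b) (pending′ b)
        where
        affordable′ : ∀ b → Affordable ((i , just b) ∷ h)
        affordable′ b j eq with j Fin.≟ i
        ... | yes ≡.refl = ⊥-elim (just≢nothing (lookup∘update i (revealed h) (just b)) eq)
        ... | no j≢i     = affordable j (≡.trans (≡.sym (lookup∘update′ j≢i (revealed h) (just b))) eq)
        pending′ : ∀ b → Pending ((i , just b) ∷ h) (v [ i ]≔ r)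
        pending′ b j eq with j Fin.≟ i
        ... | yes ≡.refl = ⊥-elim (just≢nothing (lookup∘update i (revealed h) (just b)) eq)
        ... | no j≢i with pending j (≡.trans (≡.sym (lookup∘update′ j≢i (revealed h) (just b))) eq)
        ...   | s , vⱼ≡ , cⱼ≤ = s , ≡.trans (lookup∘update′ j≢i v r) vⱼ≡ , cⱼ≤
      ...       | no ¬p = waiting i Ah (λ C → proj₂ (chosen {h} affordable ε<bias max C)) ¬p
        (computation k′ (v [ i ]≔ r) (sum-decrement-≤ v vᵢ≡ v≤k) affordable′ pending′)
        where
        affordable′ : Affordable ((i , nothing) ∷ h)
        affordable′ j eq with j Fin.≟ i
        ... | yes ≡.refl = ≰⇒≥ ¬p
        ... | no _       = affordable j eq
        -- If the counter ran out, the present investment would already reach `c i`, contrary to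
        -- `¬p`.
        remaining : ∀ r → c i ≤ investment β h i + suc r · β →
                    Σ[ s ∈ ℕ ] r ≡ suc s × c i ≤ (investment β h i + β) + suc s · β
        remaining zero    q = ⊥-elim (¬p (≤-trans q (≤-reflexive (+-congˡ (+-identityʳ β)))))
        remaining (suc s) q = s , ≡.refl , ≤-trans q (≤-reflexive (sym (+-assoc _ _ _)))
        pending′ : Pending ((i , nothing) ∷ h) (v [ i ]≔ r)
        pending′ j eq with j Fin.≟ i
        ... | yes ≡.refl with remaining r cᵢ≤
        ...   | s , r≡ , q = s , ≡.trans (lookup∘update i v r) r≡ , q
        pending′ j eq | no j≢i with pending j eq
        ...   | s , vⱼ≡ , cⱼ≤ = s , ≡.trans (lookup∘update′ j≢i v r) vⱼ≡ , cⱼ≤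

      computation-[] : Computation []
      computation-[] = computation _ v ℕ.≤-refl (λ i _ → 0≤c i) pending
        where
        steps : Fin n → ℕ
        steps i = proj₁ (archimedean (c i * β ⁻¹))
        v : Vec ℕ n
        -- `steps i` investments cover `c i`; one more keeps the counter positive even when
        -- `steps i` is 0.
        v = tabulate (suc ∘ steps)
        pending : Pending [] v
        pending i _ = steps i , lookup∘tabulate (suc ∘ steps) i , (begin
          c i                   ≤⟨ x*y⁻¹≤z⇒x≤z*y 0<β (proj₂ (archimedean (c i * β ⁻¹))) ⟩
          steps i · 1# * β      ≈⟨ k·1*x≈k·x (steps i) β ⟩
          steps i · β           ≤⟨ x≤x+y 0≤β ⟩
          steps i · β + β       ≈⟨ +-comm _ β ⟩
          suc (steps i) · β     ≈⟨ +-identityˡ _ ⟨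
          0# + suc (steps i) · β ∎)

      -- Error and expected cost of the whole run.

      halts : Halts A c β
      halts x = final t x , answer t x , run t x
        where t = computation-[]

      output-error : error f (output halts) ≤ ε
      output-error = ≤-trans
        (≤-reflexive (𝔼-cong-≗ λ x → ≡.cong (λ y → 𝟙 (answer t y xor f y)) (≡.sym (nothing-⋆ x))))
        (answer-error t)
        where t = computation-[]

      final-investment : ∀ {w} → ZeroErrorWorstCost f c w → ∀ i →
                         𝔼 (λ x → investment β (final computation-[] x) i) ≤
                         β + w * ε ⁻¹ * entropyTerm (Inf i f)
      final-investment {w} Z i = begin
        𝔼 (λ x → investment β (final t x) i)
          ≈⟨ 𝔼-cong-≗ (λ x → ≡.cong (λ y → investment β (final t y) i) (nothing-⋆ x)) ⟨
        𝔼 (λ x → investment β (final t (revealed [] ⋆ x)) i)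
          ≤⟨ investment-bound t i C (≤-reflexive p≈m) (Inf≤1 i f)
               (+-nonNegative 0≤β (*-nonNegative 0≤K (≤-trans (Inf-nonNegative i (f ↾ revealed [])) (≤-reflexive p≈m)))) ⟩
        β + w * ε ⁻¹ * (m + Inf i (f ↾ revealed []) * L m)
          ≈⟨ +-congˡ (*-congˡ (trans (+-congˡ (*-congʳ p≈m)) (entropyTerm≈ m))) ⟩
        β + w * ε ⁻¹ * entropyTerm m ∎
        where
        t = computation-[]
        m : ℝ
        m = Inf i f
        C : ∀ π → Certificate f c π w
        C = zeroError-certificate 0≤c Z
        0≤K : 0# ≤ w * ε ⁻¹
        0≤K = 0≤w*ε⁻¹ (C (revealed []))
        p≈m : Inf i (f ↾ revealed []) ≈ Inf i f
        p≈m = 𝔼-cong-≗ λ x → ≡.cong₂ (λ y z → 𝟙 (f y xor f z)) (nothing-⋆ x) (nothing-⋆ (x [ i ]%= not))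

      cost-bound : ∀ {w} → ZeroErrorWorstCost f c w →
                   𝔼 (onlineCost halts) ≤ n · β + w * ε ⁻¹ * sum (λ i → entropyTerm (Inf i f))
      cost-bound {w} Z = begin
        𝔼 (onlineCost halts)                                         ≈⟨ 𝔼-sum {n} {n} _ ⟩
        sum (λ i → 𝔼 (λ x → investment β (final computation-[] x) i)) ≤⟨ sum-mono-≤ (final-investment Z) ⟩
        sum (λ i → β + w * ε ⁻¹ * entropyTerm (Inf i f))                    ≈⟨ ∑-distrib-+ {n} _ _ ⟩
        sum {n} (λ _ → β) + sum (λ i → w * ε ⁻¹ * entropyTerm (Inf i f))    ≈⟨ +-cong (sum-replicate n) (sym (*-distribˡ-sum {n} _ _)) ⟩
        n · β + w * ε ⁻¹ * sum (λ i → entropyTerm (Inf i f))                ∎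

  -- Passage to the infimum over zero-error algorithms.

  -- For positive `s`, `x * s ⁻¹` is a lower bound of all zero-error costs, hence of their infimum,
  -- which is encoded as a negated supremum. For `s ≈ 0#`, where division fails, a single zero-error
  -- algorithm already gives x ≤ 0.
  optʷ₀-bound : ∀ {n} (f : Cube n → Bool) c {x s} → 0# ≤ s →
                (∀ {w} → ZeroErrorWorstCost f c w → x ≤ w * s) → x ≤ optʷ₀ f c * s
  optʷ₀-bound f c {x} {s} 0≤s bound with s ≟ 0#
  ... | yes s≈0 = begin
    x                                      ≤⟨ bound (proj₂ (zeroError-exists f c)) ⟩
    proj₁ (zeroError-exists f c) * s       ≈⟨ trans (*-congˡ s≈0) (zeroʳ _) ⟩
    0#                                     ≈⟨ trans (*-congˡ s≈0) (zeroʳ _) ⟨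
    optʷ₀ f c * s                          ∎
  ... | no s≉0 = x*y⁻¹≤z⇒x≤z*y 0<s (begin
    x * s ⁻¹         ≈⟨ -‿involutive _ ⟨
    - - (x * s ⁻¹)   ≤⟨ -‿anti-≤ (⋁-least _ nonEmpty (- (x * s ⁻¹)) upper) ⟩
    optʷ₀ f c        ∎)
    where
    0<s : 0# < s
    0<s = ≥∧≉⇒> 0≤s s≉0
    nonEmpty : ∃ λ y → ZeroErrorWorstCost f c (- y)
    nonEmpty = - maximum (offlineCost c (fullTree f)) ,
      offline (fullTree f) (≗⇒error≤0 {f = f} (eval-fullTree f)) (-‿involutive _)
    upper : UpperBound (λ y → ZeroErrorWorstCost f c (- y)) (- (x * s ⁻¹))
    upper y Z = begin
      y                ≈⟨ -‿involutive y ⟨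
      - - y            ≤⟨ -‿anti-≤ (x≤y*z⇒x*z⁻¹≤y 0<s (bound Z)) ⟩
      - (x * s ⁻¹)     ∎

mainTheorem2 : (R : RealField) →
    let open RealField R renaming (Carrier to ℝ)
        open PricedQuery R
    in
    (n : ℕ) (f : Cube n → Bool) (ε β : ℝ) → 0# < ε → ε ≤ ½ → 0# < β →
    Σ[ A ∈ OnlineAlgorithm n ]
      IsWarmupIPRR f ε β A ×
      ((c : Fin n → ℝ) → (∀ i → 0# ≤ c i) →
       Σ[ H ∈ Halts A c β ]
         error f (output H) ≤ ε ×
         𝔼 (onlineCost H) ≤
           n · β + (optʷ₀ f c * ε ⁻¹) * sum (λ i → entropyTerm (Inf i f)))
mainTheorem2 R n f ε β 0<ε _ 0<β = A , warm , λ c 0≤c →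
  halts f c 0≤c 0<ε 0<β warm , output-error f c 0≤c 0<ε 0<β warm , average-cost c 0≤c
  where
  open OrderedField R
  open PricedQuery R
  open Expectation R
  open Warmup R
  A : OnlineAlgorithm n
  A = proj₁ ∘ warmup f β 0<ε
  warm : IsWarmupIPRR f ε β A
  warm = proj₂ ∘ warmup f β 0<ε
  S : ℝ
  S = sum (λ i → entropyTerm (Inf i f))
  average-cost : ∀ c (0≤c : ∀ i → 0# ≤ c i) →
                 𝔼 (onlineCost (halts f c 0≤c 0<ε 0<β warm)) ≤ n · β + (optʷ₀ f c * ε ⁻¹) * S
  average-cost c 0≤c = begin
    E                                     ≤⟨ E≤ ⟩
    optʷ₀ f c * (ε ⁻¹ * S) + n · β        ≈⟨ trans (+-comm _ _) (+-congˡ (sym (*-assoc _ _ _))) ⟩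
    n · β + (optʷ₀ f c * ε ⁻¹) * S        ∎
    where
    E : ℝ
    E = 𝔼 (onlineCost (halts f c 0≤c 0<ε 0<β warm))
    0≤S : 0# ≤ S
    0≤S = sum-nonNegative {n} λ i → 0≤entropyTerm
      (Inf-nonNegative i f) (Inf≤1 i f)
    E≤ : E ≤ optʷ₀ f c * (ε ⁻¹ * S) + n · β
    -- The run does not depend on `w`, so moving `n · β` to the left and grouping `ε ⁻¹ * S` leaves
    -- a bound linear in `w`, ready for the infimum.
    E≤ = ≤-trans (≤-reflexive (sym (x-y+y≈x E (n · β)))) (+-monoˡ-≤ (n · β)
      (optʷ₀-bound f c (*-nonNegative (⁻¹-nonNegative 0<ε) 0≤S) λ {w} Z →
        +-cancelʳ-≤ (n · β) (begin
          E - n · β + n · β        ≈⟨ x-y+y≈x E (n · β) ⟩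
          E                        ≤⟨ cost-bound f c 0≤c 0<ε 0<β warm Z ⟩
          n · β + w * ε ⁻¹ * S     ≈⟨ trans (+-comm _ _) (+-congʳ (*-assoc _ _ _)) ⟩
          w * (ε ⁻¹ * S) + n · β   ∎)))
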